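{- Let $r\ge 1$ be an integer. A set $A\subseteq\mathbb{F}_2^r\setminus\{0\}$ with $|A|>\frac13\,2^r+2$ is a minimal $1$-saturating set if and only if there are a maximal sum-free set $S\subseteq\mathbb{F}_2^r$ and an element $s\in S\cup\{0\}$ such that $A=\big(s+(S\cup\{0\})\big)\setminus\{0\}$.
   Context: $\mathbb{F}_2^r$ denotes the elementary abelian $2$-group of rank $r$. For $X\subseteq\mathbb{F}_2^r$, $2X:=\{x_1+x_2\colon x_1,x_2\in X\}$ (with $x_1=x_2$ allowed), and $g+X:=\{g+x\colon x\in X\}$. A set $A\subseteq\mathbb{F}_2^r\setminus\{0\}$ is $1$-saturating if $A\cup 2A=\mathbb{F}_2^r$; it is minimal $1$-saturating if it is $1$-saturating and no proper subset of it is $1$-saturating. A set $S$ is sum-free if $S\cap 2S=\varnothing$, and maximal sum-free if it is sum-free and not properly contained in another sum-free subset of $\mathbb{F}_2^r$. -}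

module Defs where

open import Data.Bool using (Bool; true; false; _xor_; if_then_else_)
open import Data.Nat using (ℕ; zero; suc; _+_)
open import Data.Vec using (Vec; []; _∷_; zipWith; replicate)
open import Data.List using (List; []; _∷_; map; _++_)
open import Data.Nat.ListAction using (sum)
open import Data.Product using (Σ; _×_; ∃; ∃-syntax; _,_)
open import Data.Sum using (_⊎_)
open import Relation.Binary.PropositionalEquality using (_≡_; _≢_)
open import Relation.Nullary using (¬_)

V : ℕ → Set
V r = Vec Bool r

_⊕_ : ∀ {r} → V r → V r → V r
_⊕_ = zipWith _xor_

0v : ∀ {r} → V r
0v = replicate _ false

Subset₂ : ℕ → Set
Subset₂ r = V r → Bool

_∈_ : ∀ {r} → V r → Subset₂ r → Set
x ∈ A = A x ≡ true

_⊆_ : ∀ {r} → Subset₂ r → Subset₂ r → Set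
A ⊆ B = ∀ x → x ∈ A → x ∈ B

_≐_ : ∀ {r} → Subset₂ r → Subset₂ r → Set
A ≐ B = ∀ x → A x ≡ B x

-- x ∈ 2X  :  x = x₁ + x₂ with x₁, x₂ ∈ X (x₁ = x₂ allowed).
_∈2_ : ∀ {r} → V r → Subset₂ r → Set
x ∈2 X = ∃[ x₁ ] ∃[ x₂ ] (x₁ ∈ X × x₂ ∈ X × x ≡ x₁ ⊕ x₂)

AvoidsZero : ∀ {r} → Subset₂ r → Set
AvoidsZero A = ¬ (0v ∈ A)

Saturating : ∀ {r} → Subset₂ r → Set
Saturating A = AvoidsZero A × (∀ x → x ∈ A ⊎ x ∈2 A)

MinimalSaturating : ∀ {r} → Subset₂ r → Set
MinimalSaturating A =
  Saturating A × (∀ B → B ⊆ A → Saturating B → A ⊆ B)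

SumFree : ∀ {r} → Subset₂ r → Set
SumFree S = ∀ x → x ∈ S → ¬ (x ∈2 S)

MaximalSumFree : ∀ {r} → Subset₂ r → Set
MaximalSumFree S = SumFree S × (∀ T → S ⊆ T → SumFree T → T ⊆ S)

allV : ∀ r → List (V r)
allV zero = [] ∷ []
allV (suc r) = map (false ∷_) (allV r) ++ map (true ∷_) (allV r)

card : ∀ {r} → Subset₂ r → ℕ
card {r} A = sum (map (λ x → if A x then 1 else 0) (allV r))

{-# OPTIONS --safe #-}
-- Put A₀ = A ∪ {0}, n = |A₀|, N = 2^r, and let D be the set of those d which have exactly one
-- representation as an unordered sum of two elements of A₀; join x, y ∈ A₀ by an edge when
-- x + y ∈ D.  If A is minimal 1-saturating then every vertex except possibly 0 lies on an edge, and
-- A has the required form exactly when some vertex s is joined to all others.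
--
-- D has no odd relation d₁ + … + d₂ₖ₊₁ = 0.  For triangles and pentagons, A₀ would be almost
-- independent in each coset of K₄ or of the Clebsch graph, so that n would be at most about N/4 or
-- 5N/16.  For longer relations, the translates of D by the words of a simplex code in
-- d₁, …, d₇ are disjoint, so that |D| ≤ N/8 < (n - 1)/2, or else there is a shorter odd relation.
--
-- Hence some linear functional χ equals 1 on D.  In the coset χ = 1 of size N/2, an edge xy gives
-- n + |D| ≤ N/2 + deg x + deg y.  Two disjoint edges would therefore have total degree at least
-- 2n + 2|D| - N, while the other vertices contribute at least n - 5 to the degree sum 2|D|; this
-- forces 3n ≤ N + 5.  So any two edges meet, and the edges form a star.
module Submission where

open import Defs
open import Data.Bool using (Bool; true; false; _∧_; _∨_; _xor_; not; if_then_else_; T)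
open import Data.Bool.Properties using (xor-assoc; xor-comm; xor-identityˡ; xor-identityʳ; xor-same)
import Data.Bool.Properties as Bool
open import Data.Empty using (⊥; ⊥-elim)
open import Data.Fin using (Fin; zero; suc)
open import Data.List using (List; []; _∷_; length)
import Data.List as List
open import Data.List.Properties using (map-++; map-∘)
open import Data.Nat hiding (_≟_)
open import Data.Nat.ListAction using (sum)
open import Data.Nat.ListAction.Properties using (sum-++)
open import Data.Nat.Properties hiding (_≟_)
open import Data.Nat.Tactic.RingSolver using (solve-∀)
open import Data.Product using (_×_; ∃; ∃-syntax; _,_; proj₁; proj₂)
open import Data.Sum using (_⊎_; inj₁; inj₂; [_,_]′)
open import Data.Unit using (tt)
open import Data.Vec using (Vec; []; _∷_; lookup; replicate)
open import Data.Vec.Properties using (≡-dec; zipWith-assoc; zipWith-comm; zipWith-identityˡ; zipWith-identityʳ)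
open import Data.Vec.Relation.Unary.All using (All; []; _∷_)
open import Function.Bundles using (_⇔_; mk⇔; Equivalence)
open import Relation.Binary using (DecidableEquality)
open import Relation.Binary.PropositionalEquality
open import Relation.Nullary using (¬_; Dec; yes; no; does)
open import Relation.Nullary.Decidable using (map′; _⊎-dec_; _×-dec_; ¬?; decidable-stable; dec-true; dec-false)

-- Finite search and Boolean reasoning

infix 4 _≟_

_≟_ : ∀ {r} → DecidableEquality (V r)
_≟_ = ≡-dec Bool._≟_

any? : ∀ {r} {P : V r → Set} → (∀ v → Dec (P v)) → Dec (∃ P)
any? {zero} P? = map′ ([] ,_) (λ { ([] , p) → p }) (P? [])
any? {suc r} P? = map′
  (λ { (inj₁ (v , p)) → false ∷ v , p ; (inj₂ (v , p)) → true ∷ v , p })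
  (λ { (false ∷ v , p) → inj₁ (v , p) ; (true ∷ v , p) → inj₂ (v , p) })
  (any? (λ v → P? (false ∷ v)) ⊎-dec any? (λ v → P? (true ∷ v)))

∨-split : ∀ {a b} → a ∨ b ≡ true → a ≡ true ⊎ b ≡ true
∨-split {true} _ = inj₁ refl
∨-split {false} p = inj₂ p

∨-introˡ : ∀ {a b} → a ≡ true → a ∨ b ≡ true
∨-introˡ refl = refl

∨-introʳ : ∀ {a b} → b ≡ true → a ∨ b ≡ true
∨-introʳ {false} p = p
∨-introʳ {true} p = refl

≡true⇒T : ∀ {b} → b ≡ true → T b
≡true⇒T refl = tt

∧-split : ∀ {a b} → a ∧ b ≡ true → a ≡ true × b ≡ true
∧-split {true} p = refl , p

-- Linear algebra over 𝔽₂

⊕-assoc : ∀ {r} (x y z : V r) → (x ⊕ y) ⊕ z ≡ x ⊕ (y ⊕ z)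
⊕-assoc = zipWith-assoc xor-assoc

⊕-comm : ∀ {r} (x y : V r) → x ⊕ y ≡ y ⊕ x
⊕-comm = zipWith-comm xor-comm

⊕-identityˡ : ∀ {r} (x : V r) → 0v ⊕ x ≡ x
⊕-identityˡ = zipWith-identityˡ xor-identityˡ

⊕-identityʳ : ∀ {r} (x : V r) → x ⊕ 0v ≡ x
⊕-identityʳ = zipWith-identityʳ xor-identityʳ

⊕-self : ∀ {r} (x : V r) → x ⊕ x ≡ 0v
⊕-self [] = refl
⊕-self (b ∷ x) = cong₂ _∷_ (xor-same b) (⊕-self x)

-- The linear map that sends the standard basis of 𝔽₂ᵏ to `vs`. It evaluates the normal forms of the
-- solver, maps the folded cube into 𝔽₂ʳ and generates the simplex code.
comb : ∀ {k r} → V k → Vec (V r) k → V r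
comb [] [] = 0v
comb (false ∷ u) (v ∷ vs) = comb u vs
comb (true ∷ u) (v ∷ vs) = v ⊕ comb u vs

comb-⊕ : ∀ {k r} (u w : V k) (vs : Vec (V r) k) → comb (u ⊕ w) vs ≡ comb u vs ⊕ comb w vs
comb-⊕ [] [] [] = sym (⊕-identityˡ 0v)
comb-⊕ (false ∷ u) (false ∷ w) (v ∷ vs) = comb-⊕ u w vs
comb-⊕ (true ∷ u) (false ∷ w) (v ∷ vs) =
  trans (cong (v ⊕_) (comb-⊕ u w vs)) (sym (⊕-assoc v _ _))
comb-⊕ (false ∷ u) (true ∷ w) (v ∷ vs) = begin
  v ⊕ comb (u ⊕ w) vs           ≡⟨ cong (v ⊕_) (trans (comb-⊕ u w vs) (⊕-comm _ _)) ⟩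
  v ⊕ (comb w vs ⊕ comb u vs)   ≡⟨ sym (⊕-assoc v _ _) ⟩
  (v ⊕ comb w vs) ⊕ comb u vs   ≡⟨ ⊕-comm _ _ ⟩
  comb u vs ⊕ (v ⊕ comb w vs)   ∎
  where open ≡-Reasoning
comb-⊕ (true ∷ u) (true ∷ w) (v ∷ vs) = begin
  comb (u ⊕ w) vs                       ≡⟨ comb-⊕ u w vs ⟩
  comb u vs ⊕ comb w vs                 ≡⟨ cong (comb u vs ⊕_) (sym (⊕-identityˡ _)) ⟩
  comb u vs ⊕ (0v ⊕ comb w vs)          ≡⟨ cong (λ t → comb u vs ⊕ (t ⊕ comb w vs)) (sym (⊕-self v)) ⟩
  comb u vs ⊕ ((v ⊕ v) ⊕ comb w vs)     ≡⟨ cong (comb u vs ⊕_) (⊕-assoc v v _) ⟩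
  comb u vs ⊕ (v ⊕ (v ⊕ comb w vs))     ≡⟨ sym (⊕-assoc _ v _) ⟩
  (comb u vs ⊕ v) ⊕ (v ⊕ comb w vs)     ≡⟨ cong (_⊕ (v ⊕ comb w vs)) (⊕-comm _ v) ⟩
  (v ⊕ comb u vs) ⊕ (v ⊕ comb w vs)     ∎
  where open ≡-Reasoning

comb-0v : ∀ {k r} (vs : Vec (V r) k) → comb 0v vs ≡ 0v
comb-0v [] = refl
comb-0v (v ∷ vs) = comb-0v vs

unit : ∀ {k} → Fin k → V k
unit zero = true ∷ 0v
unit (suc i) = false ∷ unit i

comb-unit : ∀ {k r} (i : Fin k) (vs : Vec (V r) k) → comb (unit i) vs ≡ lookup vs i
comb-unit zero (v ∷ vs) = trans (cong (v ⊕_) (comb-0v vs)) (⊕-identityʳ v)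
comb-unit (suc i) (v ∷ vs) = comb-unit i vs

-- Deciding identities in 𝔽₂ʳ

infixr 6 _:⊕_

data Expr (k : ℕ) : Set where
  var  : Fin k → Expr k
  :0   : Expr k
  _:⊕_ : Expr k → Expr k → Expr k

⟦_⟧ : ∀ {k r} → Expr k → Vec (V r) k → V r
⟦ var i ⟧ ρ = lookup ρ i
⟦ :0 ⟧ ρ = 0v
⟦ e :⊕ f ⟧ ρ = ⟦ e ⟧ ρ ⊕ ⟦ f ⟧ ρ

normalise : ∀ {k} → Expr k → V k
normalise (var i) = unit i
normalise :0 = 0v
normalise (e :⊕ f) = normalise e ⊕ normalise f

normalise-correct : ∀ {k r} (e : Expr k) (ρ : Vec (V r) k) → ⟦ e ⟧ ρ ≡ comb (normalise e) ρ
normalise-correct (var i) ρ = sym (comb-unit i ρ)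
normalise-correct :0 ρ = sym (comb-0v ρ)
normalise-correct (e :⊕ f) ρ =
  trans (cong₂ _⊕_ (normalise-correct e ρ) (normalise-correct f ρ))
        (sym (comb-⊕ (normalise e) (normalise f) ρ))

-- The value of an expression depends only on the parity with which each variable occurs; `refl`
-- compares these parity vectors.
⊕-solve : ∀ {k r} (ρ : Vec (V r) k) (e f : Expr k) → normalise e ≡ normalise f → ⟦ e ⟧ ρ ≡ ⟦ f ⟧ ρ
⊕-solve ρ e f eq =
  trans (normalise-correct e ρ) (trans (cong (λ u → comb u ρ) eq) (sym (normalise-correct f ρ)))

pattern #0 = var zero
pattern #1 = var (suc zero)
pattern #2 = var (suc (suc zero))
pattern #3 = var (suc (suc (suc zero)))
pattern #4 = var (suc (suc (suc (suc zero))))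
pattern #5 = var (suc (suc (suc (suc (suc zero)))))
pattern #6 = var (suc (suc (suc (suc (suc (suc zero))))))
pattern #7 = var (suc (suc (suc (suc (suc (suc (suc zero)))))))
pattern #8 = var (suc (suc (suc (suc (suc (suc (suc (suc zero))))))))

x⊕[x⊕y]≡y : ∀ {r} (x y : V r) → x ⊕ (x ⊕ y) ≡ y
x⊕[x⊕y]≡y x y = ⊕-solve (x ∷ y ∷ []) (#0 :⊕ #0 :⊕ #1) #1 refl

[x⊕y]⊕y≡x : ∀ {r} (x y : V r) → (x ⊕ y) ⊕ y ≡ x
[x⊕y]⊕y≡x x y = ⊕-solve (x ∷ y ∷ []) ((#0 :⊕ #1) :⊕ #1) #0 refl

[x⊕y]⊕x≡y : ∀ {r} (x y : V r) → (x ⊕ y) ⊕ x ≡ y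
[x⊕y]⊕x≡y x y = ⊕-solve (x ∷ y ∷ []) ((#0 :⊕ #1) :⊕ #0) #1 refl

x⊕y≡0⇒x≡y : ∀ {r} (x y : V r) → x ⊕ y ≡ 0v → x ≡ y
x⊕y≡0⇒x≡y x y eq = trans (sym ([x⊕y]⊕y≡x x y)) (trans (cong (_⊕ y) eq) (⊕-identityˡ y))

-- Affine systems over 𝔽₂

dot : ∀ {r} → V r → V r → Bool
dot [] [] = false
dot (a ∷ φ) (b ∷ v) = (a ∧ b) xor dot φ v

dot-⊕ : ∀ {r} (φ u v : V r) → dot φ (u ⊕ v) ≡ dot φ u xor dot φ v
dot-⊕ [] [] [] = refl
dot-⊕ (a ∷ φ) (b ∷ u) (c ∷ v) rewrite dot-⊕ φ u v = lemma a b c (dot φ u) (dot φ v)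
  where
  lemma : ∀ a b c p q → (a ∧ (b xor c)) xor (p xor q) ≡ ((a ∧ b) xor p) xor ((a ∧ c) xor q)
  lemma false b c p q = refl
  lemma true false c p q = trans (sym (xor-assoc c p q)) (trans (cong (_xor q) (xor-comm c p)) (xor-assoc p c q))
  lemma true true false p q = Bool.not-distribˡ-xor p q
  lemma true true true p q = sym (Bool.xor-annihilates-not p q)

-- `E v b` stands for the equation `dot φ v ≡ b` in the unknown φ. `Gen E` is the span of these
-- equations, and `Gen E 0v true` is a derivation of 0 = 1.
data Gen {r} (E : V r → Bool → Bool) : V r → Bool → Set where
  none : Gen E 0v false
  add  : ∀ {v b x c} → E v b ≡ true → Gen E x c → Gen E (v ⊕ x) (b xor c)

Gen-++ : ∀ {r} {E : V r → Bool → Bool} {x y b c} → Gen E x b → Gen E y c → Gen E (x ⊕ y) (b xor c)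
Gen-++ {E = E} {y = y} {c = c} none h = subst (λ t → Gen E t c) (sym (⊕-identityˡ y)) h
Gen-++ {E = E} {y = y} {c = c} (add {v} {b} {x} {b′} e g) h =
  subst₂ (Gen E) (sym (⊕-assoc v x y)) (sym (xor-assoc b b′ c)) (add e (Gen-++ g h))

Gen-lift : ∀ {r r′} {E : V r → Bool → Bool} {F : V r′ → Bool → Bool} (f : V r → V r′) →
  f 0v ≡ 0v → (∀ u v → f (u ⊕ v) ≡ f u ⊕ f v) →
  (∀ {v b} → E v b ≡ true → Gen F (f v) b) → ∀ {x b} → Gen E x b → Gen F (f x) b
Gen-lift {F = F} f f0 f⊕ base none = subst (λ t → Gen F t false) (sym f0) none
Gen-lift {F = F} f f0 f⊕ base (add {v} {x = x} e g) =
  subst (λ t → Gen F t _) (sym (f⊕ v x)) (Gen-++ (base e) (Gen-lift f f0 f⊕ base g))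

Gen-single : ∀ {r} {E : V r → Bool → Bool} {v b} → E v b ≡ true → Gen E v b
Gen-single {E = E} {v} {b} e = subst₂ (Gen E) (⊕-identityʳ v) (xor-identityʳ b) (add e none)

Solution : ∀ {r} → (V r → Bool → Bool) → Set
Solution E = ∃[ φ ] (∀ v b → E v b ≡ true → dot φ v ≡ b)

drop-unused : ∀ {r} (E : V (suc r) → Bool → Bool) → (∀ v b → E (true ∷ v) b ≢ true) →
  let E′ = λ w e → E (false ∷ w) e in
  Solution E′ ⊎ Gen E′ 0v true → Solution E ⊎ Gen E 0v true
drop-unused E unused (inj₁ (φ , sol)) = inj₁ (false ∷ φ , λ
  { (false ∷ w) e p → sol w e p ; (true ∷ w) e p → ⊥-elim (unused w e p) })
drop-unused E unused (inj₂ g) = inj₂ (Gen-lift (false ∷_) refl (λ _ _ → refl) Gen-single g)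

-- A step of Gaussian elimination: the pivot is added to every equation with leading coefficient 1.
-- The pivot dictates the new coefficient of a solution. A derivation of 0 = 1 lifts because each
-- reduced equation is an original one or the sum of an original one and the pivot.
eliminate : ∀ {r} (E : V (suc r) → Bool → Bool) v b → E (true ∷ v) b ≡ true →
  let E′ = λ w e → E (false ∷ w) e ∨ E (true ∷ (w ⊕ v)) (e xor b) in
  Solution E′ ⊎ Gen E′ 0v true → Solution E ⊎ Gen E 0v true
eliminate {r} E v b pivot (inj₁ (φ , sol)) = inj₁ ((dot φ v xor b) ∷ φ , check)
  where
  xor-cancel : ∀ p q s → (p xor s) xor (q xor p) ≡ q xor s
  xor-cancel false false s = xor-identityʳ s
  xor-cancel false true s = trans (xor-comm s true) refl
  xor-cancel true false false = refl
  xor-cancel true false true = refl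
  xor-cancel true true s = xor-identityʳ (not s)
  check : ∀ u e → E u e ≡ true → dot ((dot φ v xor b) ∷ φ) u ≡ e
  check (false ∷ w) e p = trans (cong (_xor dot φ w) (Bool.∧-zeroʳ (dot φ v xor b))) (sol w e (∨-introˡ p))
  check (true ∷ w) e p = begin
    ((dot φ v xor b) ∧ true) xor dot φ w
      ≡⟨ cong₂ _xor_ (Bool.∧-identityʳ (dot φ v xor b)) (cong (dot φ) (sym ([x⊕y]⊕y≡x w v))) ⟩
    (dot φ v xor b) xor dot φ ((w ⊕ v) ⊕ v)
      ≡⟨ cong ((dot φ v xor b) xor_) (dot-⊕ φ (w ⊕ v) v) ⟩
    (dot φ v xor b) xor (dot φ (w ⊕ v) xor dot φ v)
      ≡⟨ xor-cancel (dot φ v) (dot φ (w ⊕ v)) b ⟩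
    dot φ (w ⊕ v) xor b
      ≡⟨ cong (_xor b) (sol (w ⊕ v) (e xor b) (∨-introʳ {E (false ∷ (w ⊕ v)) (e xor b)} p′)) ⟩
    (e xor b) xor b
      ≡⟨ xor-xor e b ⟩
    e ∎
    where
    open ≡-Reasoning
    xor-xor : ∀ p q → (p xor q) xor q ≡ p
    xor-xor p q = trans (xor-assoc p q q) (trans (cong (p xor_) (xor-same q)) (xor-identityʳ p))
    p′ : E (true ∷ ((w ⊕ v) ⊕ v)) ((e xor b) xor b) ≡ true
    p′ = subst₂ (λ t c → E (true ∷ t) c ≡ true) (sym ([x⊕y]⊕y≡x w v)) (sym (xor-xor e b)) p
eliminate {r} E v b pivot (inj₂ g) = inj₂ (Gen-lift (false ∷_) refl (λ _ _ → refl) base g)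
  where
  base : ∀ {w e} → E (false ∷ w) e ∨ E (true ∷ (w ⊕ v)) (e xor b) ≡ true → Gen E (false ∷ w) e
  base {w} {e} p with ∨-split p
  ... | inj₁ q = Gen-single q
  ... | inj₂ q = subst₂ (λ t c → Gen E (false ∷ t) c) ([x⊕y]⊕y≡x w v)
      (trans (xor-assoc e b b) (trans (cong (e xor_) (xor-same b)) (xor-identityʳ e)))
      (Gen-++ (Gen-single q) (Gen-single pivot))

-- Elimination of one coordinate at a time. If the equations are `dot φ d ≡ true` for d in D, the
-- alternatives are a functional equal to 1 on D and a vanishing sum of an odd number of elements of
-- D.
affine-alternative : ∀ {r} (E : V r → Bool → Bool) → Solution E ⊎ Gen E 0v true
affine-alternative {zero} E with E [] true in eq
... | true = inj₂ (add {v = []} eq none)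
... | false = inj₁ ([] , λ { [] false _ → refl ; [] true p → ⊥-elim (Bool.not-¬ eq p) })
affine-alternative {suc r} E
  with any? (λ v → E (true ∷ v) true Bool.≟ true) | any? (λ v → E (true ∷ v) false Bool.≟ true)
... | yes (v , p) | _ = eliminate E v true p (affine-alternative _)
... | no _ | yes (v , p) = eliminate E v false p (affine-alternative _)
... | no ¬p | no ¬q = drop-unused E
  (λ { v true p → ¬p (v , p) ; v false p → ¬q (v , p) }) (affine-alternative _)

-- Finite sums over V r

ι : Bool → ℕ
ι b = if b then 1 else 0

∑ : ∀ {r} → (V r → ℕ) → ℕ
∑ {zero} f = f []
∑ {suc r} f = ∑ (λ v → f (false ∷ v)) + ∑ (λ v → f (true ∷ v))

card≡∑ : ∀ {r} (A : Subset₂ r) → card A ≡ ∑ (λ x → ι (A x))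
card≡∑ A = sum-allV (λ x → ι (A x))
  where
  sum-allV : ∀ {r} (f : V r → ℕ) → sum (List.map f (allV r)) ≡ ∑ f
  sum-allV {zero} f = +-identityʳ (f [])
  sum-allV {suc r} f = begin
    sum (List.map f (List.map (false ∷_) (allV r) List.++ List.map (true ∷_) (allV r)))
      ≡⟨ cong sum (map-++ f (List.map (false ∷_) (allV r)) _) ⟩
    sum (List.map f (List.map (false ∷_) (allV r)) List.++ List.map f (List.map (true ∷_) (allV r)))
      ≡⟨ sum-++ (List.map f (List.map (false ∷_) (allV r))) _ ⟩
    sum (List.map f (List.map (false ∷_) (allV r))) + sum (List.map f (List.map (true ∷_) (allV r)))
      ≡⟨ cong₂ _+_ (cong sum (sym (map-∘ (allV r)))) (cong sum (sym (map-∘ (allV r)))) ⟩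
    sum (List.map (λ v → f (false ∷ v)) (allV r)) + sum (List.map (λ v → f (true ∷ v)) (allV r))
      ≡⟨ cong₂ _+_ (sum-allV (λ v → f (false ∷ v))) (sum-allV (λ v → f (true ∷ v))) ⟩
    ∑ f ∎
    where open ≡-Reasoning

∑-cong : ∀ {r} {f g : V r → ℕ} → (∀ x → f x ≡ g x) → ∑ f ≡ ∑ g
∑-cong {zero} h = h []
∑-cong {suc r} h = cong₂ _+_ (∑-cong (λ v → h (false ∷ v))) (∑-cong (λ v → h (true ∷ v)))

∑-mono : ∀ {r} {f g : V r → ℕ} → (∀ x → f x ≤ g x) → ∑ f ≤ ∑ g
∑-mono {zero} h = h []
∑-mono {suc r} h = +-mono-≤ (∑-mono (λ v → h (false ∷ v))) (∑-mono (λ v → h (true ∷ v)))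

interchange : ∀ a b c d → (a + b) + (c + d) ≡ (a + c) + (b + d)
interchange = solve-∀

∑-+ : ∀ {r} (f g : V r → ℕ) → ∑ (λ x → f x + g x) ≡ ∑ f + ∑ g
∑-+ {zero} f g = refl
∑-+ {suc r} f g = trans
  (cong₂ _+_ (∑-+ (λ v → f (false ∷ v)) (λ v → g (false ∷ v))) (∑-+ (λ v → f (true ∷ v)) (λ v → g (true ∷ v))))
  (interchange (∑ (λ v → f (false ∷ v))) _ _ _)

∑-*ˡ : ∀ {r} c (f : V r → ℕ) → ∑ (λ x → c * f x) ≡ c * ∑ f
∑-*ˡ {zero} c f = refl
∑-*ˡ {suc r} c f = trans
  (cong₂ _+_ (∑-*ˡ c (λ v → f (false ∷ v))) (∑-*ˡ c (λ v → f (true ∷ v))))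
  (sym (*-distribˡ-+ c _ _))

∑-const : ∀ {r} c → ∑ {r} (λ _ → c) ≡ c * 2 ^ r
∑-const {zero} c = sym (*-identityʳ c)
∑-const {suc r} c = trans (cong₂ _+_ (∑-const {r} c) (∑-const {r} c)) (double c (2 ^ r))
  where
  double : ∀ c n → c * n + c * n ≡ c * (n + (n + 0))
  double = solve-∀

∑-translate : ∀ {r} (t : V r) (f : V r → ℕ) → ∑ (λ x → f (x ⊕ t)) ≡ ∑ f
∑-translate [] f = refl
∑-translate (false ∷ t) f =
  cong₂ _+_ (∑-translate t (λ v → f (false ∷ v))) (∑-translate t (λ v → f (true ∷ v)))
∑-translate (true ∷ t) f = trans
  (cong₂ _+_ (∑-translate t (λ v → f (true ∷ v))) (∑-translate t (λ v → f (false ∷ v))))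
  (+-comm (∑ (λ v → f (true ∷ v))) _)

∑-swap : ∀ {r k} (f : V r → V k → ℕ) → ∑ (λ x → ∑ (λ y → f x y)) ≡ ∑ (λ y → ∑ (λ x → f x y))
∑-swap {zero} f = refl
∑-swap {suc r} f = trans
  (cong₂ _+_ (∑-swap (λ v → f (false ∷ v))) (∑-swap (λ v → f (true ∷ v))))
  (sym (∑-+ (λ y → ∑ (λ v → f (false ∷ v) y)) _))

[_＝_] : ∀ {r} → V r → V r → ℕ
[ x ＝ p ] = ι (does (x ≟ p))

∑-point : ∀ {r} (p : V r) → ∑ (λ x → [ x ＝ p ]) ≡ 1
∑-point {r} p = trans (sym (∑-translate p _)) (trans (∑-cong shift) (∑-zero {r}))
  where
  shift : ∀ x → [ x ⊕ p ＝ p ] ≡ [ x ＝ 0v ]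
  shift x with x ≟ 0v
  ... | yes refl = cong ι (dec-true (0v ⊕ p ≟ p) (⊕-identityˡ p))
  ... | no x≢0 = cong ι (dec-false (x ⊕ p ≟ p)
    (λ eq → x≢0 (trans (sym ([x⊕y]⊕y≡x x p)) (trans (cong (_⊕ p) eq) (⊕-self p)))))
  ∑-zero : ∀ {r} → ∑ {r} (λ x → [ x ＝ 0v ]) ≡ 1
  ∑-zero {zero} = refl
  ∑-zero {suc r} = cong₂ _+_ (∑-zero {r}) (∑-const {r} 0)

∑-atMostOne : ∀ {r} (b : V r → Bool) → (∀ u v → b u ≡ true → b v ≡ true → u ≡ v) →
  ∑ (λ u → ι (b u)) ≤ 1
∑-atMostOne {r} b unique with any? (λ u → b u Bool.≟ true)
... | yes (p , bp) = ≤-trans (∑-mono below) (≤-reflexive (∑-point p))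
  where
  below : ∀ u → ι (b u) ≤ [ u ＝ p ]
  below u with b u in bu | u ≟ p
  ... | false | _ = z≤n
  ... | true | yes _ = ≤-refl
  ... | true | no u≢p = ⊥-elim (u≢p (unique u p bu bp))
... | no ¬∃ = ≤-trans (∑-mono {g = λ _ → 0} below) (≤-trans (≤-reflexive (∑-const {r} 0)) z≤n)
  where
  below : ∀ u → ι (b u) ≤ 0
  below u with b u in bu
  ... | false = z≤n
  ... | true = ⊥-elim (¬∃ (u , bu))

term≤∑ : ∀ {r} (f : V r → ℕ) (p : V r) → f p ≤ ∑ f
term≤∑ f p = begin
  f p                          ≡⟨ sym (*-identityʳ (f p)) ⟩
  f p * 1                      ≡⟨ cong (f p *_) (sym (∑-point p)) ⟩
  f p * ∑ (λ x → [ x ＝ p ])    ≡⟨ sym (∑-*ˡ (f p) (λ x → [ x ＝ p ])) ⟩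
  ∑ (λ x → f p * [ x ＝ p ])    ≤⟨ ∑-mono below ⟩
  ∑ f                          ∎
  where
  open ≤-Reasoning
  below : ∀ x → f p * [ x ＝ p ] ≤ f x
  below x with x ≟ p
  ... | yes refl = ≤-reflexive (*-identityʳ (f p))
  ... | no _ = ≤-trans (≤-reflexive (*-zeroʳ (f p))) z≤n

-- Averaging over the translates of a folded cube

isZero isUnit isOnes : ∀ {k} → V k → Bool
isZero [] = true
isZero (b ∷ v) = not b ∧ isZero v
isUnit [] = false
isUnit (false ∷ v) = isUnit v
isUnit (true ∷ v) = isZero v
isOnes [] = true
isOnes (b ∷ v) = b ∧ isOnes v

-- The folded (k + 1)-cube: K₄ for k = 2, the Clebsch graph for k = 4.
adj : ∀ {k} → V k → V k → Bool
adj u v = isUnit (u ⊕ v) ∨ isOnes (u ⊕ v)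

neighbours : ∀ {k} → V k → List (V k) → ℕ
neighbours v [] = 0
neighbours v (w ∷ ws) = ι (adj v w) + neighbours v ws

adjacentPairs : ∀ {k} → List (V k) → ℕ
adjacentPairs [] = 0
adjacentPairs (v ∷ vs) = neighbours v vs + adjacentPairs vs

count : ∀ {k} → (V k → Bool) → List (V k) → ℕ
count b [] = 0
count b (v ∷ vs) = ι (b v) + count b vs

link : ∀ {k} → (V k → Bool) → V k → List (V k) → ℕ
link b v [] = 0
link b v (w ∷ ws) = ι (adj v w) * ι (b w) + link b v ws

induced : ∀ {k} → (V k → Bool) → List (V k) → ℕ
induced b [] = 0
induced b (v ∷ vs) = ι (b v) * link b v vs + induced b vs

-- bounded p q vs cs hi lo checks that lo + p·|S| ≤ hi + q·(edges of S ∪ cs meeting S) for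
-- every S ⊆ vs; a branch is cut as soon as even S = vs would satisfy this without any edge.
bounded : ∀ {k} (p q : ℕ) → List (V k) → List (V k) → ℕ → ℕ → Bool
bounded p q [] cs hi lo = lo ≤ᵇ hi
bounded p q (v ∷ vs) cs hi lo =
  (lo + p * suc (length vs) ≤ᵇ hi) ∨
  (bounded p q vs cs hi lo ∧ bounded p q vs (v ∷ cs) (hi + q * neighbours v cs) (lo + p))

-- In the search of `bounded`, `cs` holds the vertices already put into S, so this counts the edges
-- from them to the members of S among the undecided vertices.
cross : ∀ {k} → (V k → Bool) → List (V k) → List (V k) → ℕ
cross b [] cs = 0
cross b (v ∷ vs) cs = ι (b v) * neighbours v cs + cross b vs cs

adj-sym : ∀ {k} (u v : V k) → adj u v ≡ adj v u
adj-sym u v = cong (λ t → isUnit t ∨ isOnes t) (⊕-comm u v)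

cross-∷ : ∀ {k} (b : V k → Bool) vs v cs → cross b vs (v ∷ cs) ≡ link b v vs + cross b vs cs
cross-∷ b [] v cs = refl
cross-∷ b (w ∷ vs) v cs = begin
  ι (b w) * (ι (adj w v) + neighbours w cs) + cross b vs (v ∷ cs)
    ≡⟨ cong₂ (λ s t → ι (b w) * (ι s + neighbours w cs) + t) (adj-sym w v) (cross-∷ b vs v cs) ⟩
  ι (b w) * (ι (adj v w) + neighbours w cs) + (link b v vs + cross b vs cs)
    ≡⟨ rearrange (ι (b w)) (ι (adj v w)) (neighbours w cs) (link b v vs) (cross b vs cs) ⟩
  (ι (adj v w) * ι (b w) + link b v vs) + (ι (b w) * neighbours w cs + cross b vs cs) ∎
  where
  open ≡-Reasoning
  rearrange : ∀ x a n l c → x * (a + n) + (l + c) ≡ (a * x + l) + (x * n + c)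
  rearrange = solve-∀

count≤length : ∀ {k} (b : V k → Bool) vs → count b vs ≤ length vs
count≤length b [] = z≤n
count≤length b (v ∷ vs) with b v
... | true = s≤s (count≤length b vs)
... | false = ≤-trans (count≤length b vs) (n≤1+n _)

-- Induction along the search. Taking v into S adds p to `lo` and q to `hi` for each edge to `cs`,
-- while its edges to later vertices pass from `induced` to `cross`. A cut is sound because S has at
-- most `length vs` members left after v.
bounded-sound : ∀ {k} p q (b : V k → Bool) vs cs hi lo → bounded p q vs cs hi lo ≡ true →
  lo + p * count b vs ≤ hi + q * (cross b vs cs + induced b vs)
bounded-sound p q b [] cs hi lo h = begin
  lo + p * 0   ≡⟨ trans (cong (lo +_) (*-zeroʳ p)) (+-identityʳ lo) ⟩
  lo           ≤⟨ ≤ᵇ⇒≤ lo hi (≡true⇒T h) ⟩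
  hi           ≤⟨ m≤m+n hi _ ⟩
  hi + q * 0   ∎
  where open ≤-Reasoning
bounded-sound p q b (v ∷ vs) cs hi lo h with ∨-split {lo + p * suc (length vs) ≤ᵇ hi} h
... | inj₁ cut = begin
  lo + p * count b (v ∷ vs)   ≤⟨ +-monoʳ-≤ lo (*-monoʳ-≤ p (count≤length b (v ∷ vs))) ⟩
  lo + p * suc (length vs)    ≤⟨ ≤ᵇ⇒≤ _ hi (≡true⇒T cut) ⟩
  hi                          ≤⟨ m≤m+n hi _ ⟩
  hi + q * (cross b (v ∷ vs) cs + induced b (v ∷ vs)) ∎
  where open ≤-Reasoning
... | inj₂ both with ∧-split {bounded p q vs cs hi lo} both | b v
... | without , _ | false = bounded-sound p q b vs cs hi lo without
... | _ , with-v | true = begin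
  lo + p * suc (count b vs)
    ≡⟨ take-lo lo p (count b vs) ⟩
  (lo + p) + p * count b vs
    ≤⟨ bounded-sound p q b vs (v ∷ cs) (hi + q * neighbours v cs) (lo + p) with-v ⟩
  (hi + q * neighbours v cs) + q * (cross b vs (v ∷ cs) + induced b vs)
    ≡⟨ cong (λ t → (hi + q * neighbours v cs) + q * (t + induced b vs)) (cross-∷ b vs v cs) ⟩
  (hi + q * neighbours v cs) + q * ((link b v vs + cross b vs cs) + induced b vs)
    ≡⟨ take-hi hi q (neighbours v cs) (link b v vs) (cross b vs cs) (induced b vs) ⟩
  hi + q * ((1 * neighbours v cs + cross b vs cs) + (1 * link b v vs + induced b vs)) ∎
  where
  open ≤-Reasoning
  take-lo : ∀ l p c → l + p * suc c ≡ (l + p) + p * c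
  take-lo = solve-∀
  take-hi : ∀ h q n l c i → (h + q * n) + q * ((l + c) + i) ≡ h + q * ((1 * n + c) + (1 * l + i))
  take-hi = solve-∀

cross-[] : ∀ {k} (b : V k → Bool) vs → cross b vs [] ≡ 0
cross-[] b [] = refl
cross-[] b (v ∷ vs) = cong₂ _+_ (*-zeroʳ (ι (b v))) (cross-[] b vs)

isZero⇒comb≡0v : ∀ {k r} (w : V k) (ds : Vec (V r) k) → isZero w ≡ true → comb w ds ≡ 0v
isZero⇒comb≡0v [] [] _ = refl
isZero⇒comb≡0v (false ∷ w) (d ∷ ds) z = isZero⇒comb≡0v w ds z

module _ {r} (A : Subset₂ r) where

  rep : V r → ℕ
  rep d = ∑ (λ x → ι (A x) * ι (A (x ⊕ d)))

  -- `rep` counts ordered pairs, so for d ≠ 0 the value 2 means one unordered pair. For d = 0 it is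
  -- |A|, a case that `0∉D` excludes for large A.
  D : Subset₂ r
  D d = rep d ≡ᵇ 2

  D⇒rep≡2 : ∀ {d} → d ∈ D → rep d ≡ 2
  D⇒rep≡2 {d} h = ≡ᵇ⇒≡ (rep d) 2 (≡true⇒T h)

  isUnit⇒∈D : ∀ {k} (w : V k) {ds} → All (_∈ D) ds → isUnit w ≡ true → comb w ds ∈ D
  isUnit⇒∈D (false ∷ w) (_ ∷ hs) u = isUnit⇒∈D w hs u
  isUnit⇒∈D (true ∷ w) {d ∷ ds} (h ∷ hs) z =
    subst (_∈ D) (sym (trans (cong (d ⊕_) (isZero⇒comb≡0v w ds z)) (⊕-identityʳ d))) h

  module _ {k} (ds : Vec (V r) k) (generators : ∀ w → isUnit w ∨ isOnes w ≡ true → comb w ds ∈ D) where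

    -- The trace of A on the translate by g of the image of the cube. Reading it on the cube's
    -- vertices also covers linearly dependent `ds`.
    pull : V r → V k → Bool
    pull g u = A (g ⊕ comb u ds)

    ∑-count : ∀ vs → ∑ (λ g → count (pull g) vs) ≡ length vs * ∑ (λ x → ι (A x))
    ∑-count [] = ∑-const {r} 0
    ∑-count (v ∷ vs) = trans (∑-+ (λ g → ι (pull g v)) (λ g → count (pull g) vs))
      (cong₂ _+_ (∑-translate (comb v ds) (λ x → ι (A x))) (∑-count vs))

    -- For adjacent v and w, a translation turns the sum into `rep` at the difference of their
    -- images, which lies in `D`.
    ∑-pair : ∀ v w → ∑ (λ g → ι (pull g v) * (ι (adj v w) * ι (pull g w))) ≡ 2 * ι (adj v w)
    ∑-pair v w with adj v w in eq
    ... | false = trans (∑-cong {g = λ _ → 0} (λ g → *-zeroʳ (ι (pull g v)))) (∑-const {r} 0)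
    ... | true = begin
      ∑ (λ g → ι (pull g v) * (1 * ι (pull g w)))
        ≡⟨ ∑-cong (λ g → cong (ι (pull g v) *_) (trans (*-identityˡ _) (cong (λ t → ι (A t)) (shift g)))) ⟩
      ∑ (λ g → ι (A (g ⊕ comb v ds)) * ι (A ((g ⊕ comb v ds) ⊕ comb (v ⊕ w) ds)))
        ≡⟨ ∑-translate (comb v ds) (λ x → ι (A x) * ι (A (x ⊕ comb (v ⊕ w) ds))) ⟩
      rep (comb (v ⊕ w) ds)
        ≡⟨ D⇒rep≡2 (generators (v ⊕ w) eq) ⟩
      2 ∎
      where
      open ≡-Reasoning
      shift : ∀ g → g ⊕ comb w ds ≡ (g ⊕ comb v ds) ⊕ comb (v ⊕ w) ds
      shift g = trans (⊕-solve (g ∷ comb v ds ∷ comb w ds ∷ []) (#0 :⊕ #2) ((#0 :⊕ #1) :⊕ #1 :⊕ #2) refl)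
        (cong ((g ⊕ comb v ds) ⊕_) (sym (comb-⊕ v w ds)))

    ∑-link : ∀ v ws → ∑ (λ g → ι (pull g v) * link (pull g) v ws) ≡ 2 * neighbours v ws
    ∑-link v [] = trans (∑-cong {g = λ _ → 0} (λ g → *-zeroʳ (ι (pull g v)))) (∑-const {r} 0)
    ∑-link v (w ∷ ws) = begin
      ∑ (λ g → ι (pull g v) * (ι (adj v w) * ι (pull g w) + link (pull g) v ws))
        ≡⟨ ∑-cong (λ g → *-distribˡ-+ (ι (pull g v)) (ι (adj v w) * ι (pull g w)) (link (pull g) v ws)) ⟩
      ∑ (λ g → ι (pull g v) * (ι (adj v w) * ι (pull g w)) + ι (pull g v) * link (pull g) v ws)
        ≡⟨ ∑-+ (λ g → ι (pull g v) * (ι (adj v w) * ι (pull g w))) (λ g → ι (pull g v) * link (pull g) v ws) ⟩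
      _ ≡⟨ cong₂ _+_ (∑-pair v w) (∑-link v ws) ⟩
      2 * ι (adj v w) + 2 * neighbours v ws
        ≡⟨ sym (*-distribˡ-+ 2 (ι (adj v w)) (neighbours v ws)) ⟩
      2 * neighbours v (w ∷ ws) ∎
      where open ≡-Reasoning

    ∑-induced : ∀ vs → ∑ (λ g → induced (pull g) vs) ≡ 2 * adjacentPairs vs
    ∑-induced [] = ∑-const {r} 0
    ∑-induced (v ∷ vs) = begin
      ∑ (λ g → ι (pull g v) * link (pull g) v vs + induced (pull g) vs)
        ≡⟨ ∑-+ (λ g → ι (pull g v) * link (pull g) v vs) (λ g → induced (pull g) vs) ⟩
      _ ≡⟨ cong₂ _+_ (∑-link v vs) (∑-induced vs) ⟩
      2 * neighbours v vs + 2 * adjacentPairs vs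
        ≡⟨ sym (*-distribˡ-+ 2 (neighbours v vs) (adjacentPairs vs)) ⟩
      2 * adjacentPairs (v ∷ vs) ∎
      where open ≡-Reasoning

    -- The local inequality p|S| ≤ c + q e(S) is summed over all translates. Each vertex then
    -- contributes |A|, and each edge exactly 2.
    averaged-bound : ∀ p q c vs → bounded p q vs [] c 0 ≡ true →
      p * (length vs * ∑ (λ x → ι (A x))) ≤ c * 2 ^ r + q * (2 * adjacentPairs vs)
    averaged-bound p q c vs ok = begin
      p * (length vs * ∑ (λ x → ι (A x)))
        ≡⟨ cong (p *_) (sym (∑-count vs)) ⟩
      p * ∑ (λ g → count (pull g) vs)
        ≡⟨ sym (∑-*ˡ p (λ g → count (pull g) vs)) ⟩
      ∑ (λ g → p * count (pull g) vs)
        ≤⟨ ∑-mono (λ g → subst (λ t → p * count (pull g) vs ≤ c + q * (t + induced (pull g) vs))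
             (cross-[] (pull g) vs) (bounded-sound p q (pull g) vs [] c 0 ok)) ⟩
      ∑ (λ g → c + q * induced (pull g) vs)
        ≡⟨ ∑-+ (λ _ → c) (λ g → q * induced (pull g) vs) ⟩
      _ ≡⟨ cong₂ _+_ (∑-const {r} c) (trans (∑-*ˡ q (λ g → induced (pull g) vs)) (cong (q *_) (∑-induced vs))) ⟩
      c * 2 ^ r + q * (2 * adjacentPairs vs) ∎
      where open ≤-Reasoning

-- Odd relations between unique sums

isOnes⇒≡ : ∀ {k} (w : V k) → isOnes w ≡ true → w ≡ replicate k true
isOnes⇒≡ [] _ = refl
isOnes⇒≡ (true ∷ w) h = cong (true ∷_) (isOnes⇒≡ w h)

three-points : ∀ {r} (f : V r → ℕ) {p q s} → p ≢ q → p ≢ s → q ≢ s →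
  1 ≤ f p → 1 ≤ f q → 1 ≤ f s → 3 ≤ ∑ f
three-points f {p} {q} {s} p≢q p≢s q≢s fp fq fs = begin
  1 + (1 + 1)
    ≡⟨ sym (cong₂ _+_ (∑-point p) (cong₂ _+_ (∑-point q) (∑-point s))) ⟩
  ∑ (λ x → [ x ＝ p ]) + (∑ (λ x → [ x ＝ q ]) + ∑ (λ x → [ x ＝ s ]))
    ≡⟨ sym (trans (∑-+ (λ x → [ x ＝ p ]) _) (cong (∑ (λ x → [ x ＝ p ]) +_) (∑-+ (λ x → [ x ＝ q ]) _))) ⟩
  ∑ (λ x → [ x ＝ p ] + ([ x ＝ q ] + [ x ＝ s ]))
    ≤⟨ ∑-mono below ⟩
  ∑ f ∎
  where
  open ≤-Reasoning
  below : ∀ x → [ x ＝ p ] + ([ x ＝ q ] + [ x ＝ s ]) ≤ f x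
  below x with x ≟ p | x ≟ q | x ≟ s
  ... | yes refl | no _ | no _ = fp
  ... | no _ | yes refl | no _ = fq
  ... | no _ | no _ | yes refl = fs
  ... | no _ | no _ | no _ = z≤n
  ... | yes e | yes e′ | _ = ⊥-elim (p≢q (trans (sym e) e′))
  ... | yes e | no _ | yes e′ = ⊥-elim (p≢s (trans (sym e) e′))
  ... | no _ | yes e | yes e′ = ⊥-elim (q≢s (trans (sym e) e′))

-- The 12 is twice the number of edges of K₄. The bound puts n near N/4, below N/3.
triangle-arith : ∀ n N → N + 10 ≤ 3 * n → 1 * (4 * n) ≤ 1 * N + 1 * 12 → ⊥
triangle-arith n N h₁ h₂ = m+1+n≰m (3 * (N + 12)) {N + 3} (begin
  3 * (N + 12) + suc (N + 3)   ≡⟨ e₁ N ⟩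
  4 * (N + 10)                 ≤⟨ *-monoʳ-≤ 4 h₁ ⟩
  4 * (3 * n)                  ≡⟨ e₂ n ⟩
  3 * (1 * (4 * n))            ≤⟨ *-monoʳ-≤ 3 h₂ ⟩
  3 * (1 * N + 1 * 12)         ≡⟨ e₃ N ⟩
  3 * (N + 12)                 ∎)
  where
  open ≤-Reasoning
  e₁ : ∀ N → 3 * (N + 12) + suc (N + 3) ≡ 4 * (N + 10)
  e₁ = solve-∀
  e₂ : ∀ n → 4 * (3 * n) ≡ 3 * (1 * (4 * n))
  e₂ = solve-∀
  e₃ : ∀ N → 3 * (1 * N + 1 * 12) ≡ 3 * (N + 12)
  e₃ = solve-∀

-- The 80 is twice the number of edges of the Clebsch graph. The averaged bound amounts to 16n ≤ 5N
-- + 60, which with 3n ≥ N + 10 leaves only N ≤ 20. The bound 2n ≤ N + 2 gives N ≥ 14 and excludes r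
-- ≤ 3; for r = 4 one would have n ≥ 9 and 16n ≤ 140.
pentagon-arith : ∀ r n → 2 ^ r + 10 ≤ 3 * n → 2 * n ≤ 2 ^ r + 2 →
  4 * (16 * n) ≤ 20 * 2 ^ r + 3 * 80 → ⊥
pentagon-arith r n h₁ h₂ h₃ = cases r h₁ h₃′ (begin
  2 * (2 ^ r + 10)   ≤⟨ *-monoʳ-≤ 2 h₁ ⟩
  2 * (3 * n)        ≡⟨ trans (sym (*-assoc 2 3 n)) (*-assoc 3 2 n) ⟩
  3 * (2 * n)        ≤⟨ *-monoʳ-≤ 3 h₂ ⟩
  3 * (2 ^ r + 2)    ∎)
  where
  open ≤-Reasoning
  h₃′ : 16 * n ≤ 5 * 2 ^ r + 60
  h₃′ = *-cancelˡ-≤ 4 (begin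
    4 * (16 * n)              ≤⟨ h₃ ⟩
    20 * 2 ^ r + 240          ≡⟨ cong (_+ 240) (*-assoc 4 5 (2 ^ r)) ⟩
    4 * (5 * 2 ^ r) + 4 * 60  ≡⟨ sym (*-distribˡ-+ 4 (5 * 2 ^ r) 60) ⟩
    4 * (5 * 2 ^ r + 60)      ∎)
  N≤20 : ∀ N → N + 10 ≤ 3 * n → 16 * n ≤ 5 * N + 60 → N ≤ 20
  N≤20 N g₁ g₃ = +-cancelʳ-≤ (15 * N + 160) N 20 (begin
    N + (15 * N + 160)       ≡⟨ sym (+-assoc N (15 * N) 160) ⟩
    16 * N + 16 * 10         ≡⟨ sym (*-distribˡ-+ 16 N 10) ⟩
    16 * (N + 10)            ≤⟨ *-monoʳ-≤ 16 g₁ ⟩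
    16 * (3 * n)             ≡⟨ trans (sym (*-assoc 16 3 n)) (*-assoc 3 16 n) ⟩
    3 * (16 * n)             ≤⟨ *-monoʳ-≤ 3 g₃ ⟩
    3 * (5 * N + 60)         ≡⟨ *-distribˡ-+ 3 (5 * N) 60 ⟩
    3 * (5 * N) + 180        ≡⟨ cong (_+ 180) (sym (*-assoc 3 5 N)) ⟩
    15 * N + (160 + 20)      ≡⟨ sym (+-assoc (15 * N) 160 20) ⟩
    (15 * N + 160) + 20      ≡⟨ +-comm (15 * N + 160) 20 ⟩
    20 + (15 * N + 160)      ∎)
  cases : ∀ r → 2 ^ r + 10 ≤ 3 * n → 16 * n ≤ 5 * 2 ^ r + 60 →
    2 * (2 ^ r + 10) ≤ 3 * (2 ^ r + 2) → ⊥
  cases 0 _ _ g = ≤⇒≤ᵇ g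
  cases 1 _ _ g = ≤⇒≤ᵇ g
  cases 2 _ _ g = ≤⇒≤ᵇ g
  cases 3 _ _ g = ≤⇒≤ᵇ g
  cases 4 g₁ g₃ _ with n ≤? 8
  ... | yes n≤8 = ≤⇒≤ᵇ (≤-trans g₁ (*-monoʳ-≤ 3 n≤8))
  ... | no n≰8 = ≤⇒≤ᵇ (≤-trans (*-monoʳ-≤ 16 (≰⇒> n≰8)) g₃)
  cases (suc (suc (suc (suc (suc k))))) g₁ g₃ _ =
    ≤⇒≤ᵇ (≤-trans (^-monoʳ-≤ 2 (m≤m+n 5 k)) (N≤20 (2 ^ (5 + k)) g₁ g₃))

simplex-arith : ∀ n s N → N + 10 ≤ 3 * n → n ≤ 2 * s + 1 → s * 8 ≤ 1 * N → ⊥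
simplex-arith n s N h₁ h₂ h₃ = m+1+n≰m (3 * N + 12) {N + 27} (begin
  3 * N + 12 + suc (N + 27)   ≡⟨ e₁ N ⟩
  4 * (N + 10)                ≤⟨ *-monoʳ-≤ 4 h₁ ⟩
  4 * (3 * n)                 ≤⟨ *-monoʳ-≤ 4 (*-monoʳ-≤ 3 h₂) ⟩
  4 * (3 * (2 * s + 1))       ≡⟨ e₂ s ⟩
  3 * (s * 8) + 12            ≤⟨ +-monoˡ-≤ 12 (*-monoʳ-≤ 3 h₃) ⟩
  3 * (1 * N) + 12            ≡⟨ e₃ N ⟩
  3 * N + 12                  ∎)
  where
  open ≤-Reasoning
  e₁ : ∀ N → 3 * N + 12 + suc (N + 27) ≡ 4 * (N + 10)
  e₁ = solve-∀
  e₂ : ∀ s → 4 * (3 * (2 * s + 1)) ≡ 3 * (s * 8) + 12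
  e₂ = solve-∀
  e₃ : ∀ N → 3 * (1 * N) + 12 ≡ 3 * N + 12
  e₃ = solve-∀

dbl : ℕ → ℕ
dbl zero = 0
dbl (suc k) = suc (suc (dbl k))

isOdd : ℕ → Bool
isOdd zero = false
isOdd (suc n) = not (isOdd n)

isOdd⇒≡1+dbl : ∀ n → isOdd n ≡ true → ∃[ k ] n ≡ suc (dbl k)
isOdd⇒≡1+dbl (suc zero) _ = 0 , refl
isOdd⇒≡1+dbl (suc (suc n)) h with isOdd⇒≡1+dbl n (trans (sym (Bool.not-involutive (isOdd n))) h)
... | k , refl = suc k , refl

data SumOf {r} (D : Subset₂ r) : ℕ → V r → Set where
  []  : SumOf D 0 0v
  _∷_ : ∀ {d n x} → d ∈ D → SumOf D n x → SumOf D (suc n) (d ⊕ x)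

-- Every equation has right-hand side 1, so the right-hand side of a sum of equations is the parity
-- of the number of summands.
Gen⇒SumOf : ∀ {r} {D : Subset₂ r} {x c} → Gen (λ d b → D d ∧ b) x c →
  ∃[ n ] (SumOf D n x × isOdd n ≡ c)
Gen⇒SumOf none = 0 , [] , refl
Gen⇒SumOf {D = D} (add {v} {b} e g) with ∧-split {D v} e | Gen⇒SumOf g
... | d∈D , refl | n , t , refl = suc n , d∈D ∷ t , refl

module Large {r} (A : Subset₂ r) (big : 2 ^ r + 10 ≤ 3 * ∑ (λ x → ι (A x))) where

  n = ∑ (λ x → ι (A x))
  s = ∑ (λ d → ι (D A d))

  -- `rep A 0v` is |A|, so membership would force n = 2, against `big`.
  0∉D : ¬ (0v ∈ D A)
  0∉D h = ≤⇒≤ᵇ (begin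
    10           ≤⟨ m≤n+m 10 (2 ^ r) ⟩
    2 ^ r + 10   ≤⟨ big ⟩
    3 * n        ≡⟨ cong (3 *_) (trans (∑-cong same) (D⇒rep≡2 A h)) ⟩
    6            ∎)
    where
    open ≤-Reasoning
    same : ∀ x → ι (A x) ≡ ι (A x) * ι (A (x ⊕ 0v))
    same x rewrite ⊕-identityʳ x with A x
    ... | true = refl
    ... | false = refl

  edge-distinct : ∀ {x y} → (x ⊕ y) ∈ D A → x ≢ y
  edge-distinct {x} h refl = 0∉D (subst (_∈ D A) (⊕-self x) h)

  -- Otherwise x, y and z would start three ordered representations of x + y, and `rep` allows two.
  edge-unique : ∀ {x y z w} → x ∈ A → y ∈ A → (x ⊕ y) ∈ D A → z ∈ A → w ∈ A → z ⊕ w ≡ x ⊕ y → z ≡ x ⊎ z ≡ y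
  edge-unique {x} {y} {z} {w} x∈A y∈A xy∈D z∈A w∈A eq with z ≟ x | z ≟ y
  ... | yes p | _ = inj₁ p
  ... | no _ | yes p = inj₂ p
  ... | no z≢x | no z≢y = ⊥-elim (1+n≰n (≤-trans
    (three-points (λ u → ι (A u) * ι (A (u ⊕ (x ⊕ y)))) (edge-distinct xy∈D) (≢-sym z≢x) (≢-sym z≢y)
      (pair x∈A (subst (_∈ A) (sym (x⊕[x⊕y]≡y x y)) y∈A))
      (pair y∈A (subst (_∈ A) (sym (trans (cong (y ⊕_) (⊕-comm x y)) (x⊕[x⊕y]≡y y x))) x∈A))
      (pair z∈A (subst (_∈ A) (sym (trans (cong (z ⊕_) (sym eq)) (x⊕[x⊕y]≡y z w))) w∈A)))
    (≤-reflexive (D⇒rep≡2 A xy∈D))))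
    where
    pair : ∀ {u v} → u ∈ A → v ∈ A → 1 ≤ ι (A u) * ι (A v)
    pair p q rewrite p | q = ≤-refl

  -- A and A + d share exactly two points, so their union has 2n - 2 elements.
  2n≤N+2 : ∀ {d} → d ∈ D A → 2 * n ≤ 2 ^ r + 2
  2n≤N+2 {d} h = begin
    2 * n                                                 ≡⟨ cong (n +_) (+-identityʳ n) ⟩
    n + n                                                 ≡⟨ cong (n +_) (sym (∑-translate d (λ x → ι (A x)))) ⟩
    n + ∑ (λ x → ι (A (x ⊕ d)))                           ≡⟨ sym (∑-+ (λ x → ι (A x)) (λ x → ι (A (x ⊕ d)))) ⟩
    ∑ (λ x → ι (A x) + ι (A (x ⊕ d)))                     ≤⟨ ∑-mono (λ x → below (A x) (A (x ⊕ d))) ⟩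
    ∑ (λ x → 1 + ι (A x) * ι (A (x ⊕ d)))                 ≡⟨ ∑-+ (λ _ → 1) (λ x → ι (A x) * ι (A (x ⊕ d))) ⟩
    ∑ {r} (λ _ → 1) + rep A d                             ≡⟨ cong₂ _+_ (trans (∑-const {r} 1) (*-identityˡ (2 ^ r))) (D⇒rep≡2 A h) ⟩
    2 ^ r + 2                                             ∎
    where
    open ≤-Reasoning
    below : ∀ a b → ι a + ι b ≤ 1 + ι a * ι b
    below true true = ≤-refl
    below true false = ≤-refl
    below false true = ≤-refl
    below false false = z≤n

  generators : ∀ {k} {ds : Vec (V r) k} → All (_∈ D A) ds → comb (replicate k true) ds ∈ D A →
    ∀ w → isUnit w ∨ isOnes w ≡ true → comb w ds ∈ D A
  generators {ds = ds} units ones w h with ∨-split {isUnit w} h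
  ... | inj₁ u = isUnit⇒∈D A w units u
  ... | inj₂ o = subst (λ t → comb t ds ∈ D A) (sym (isOnes⇒≡ w o)) ones

  module _ (n≤2s+1 : n ≤ 2 * s + 1) where

    -- If no relation has 5 + m terms, the eight translates of D by the codewords in d₁, ..., d₇ are
    -- disjoint. Then 8|D| ≤ N, which contradicts `big` in view of n ≤ 2|D| + 1.
    shorten-relation : ∀ {m} → (∀ {y} → SumOf (D A) (5 + m) y → y ≢ 0v) →
      ∀ {x} → SumOf (D A) (7 + m) x → x ≢ 0v
    shorten-relation shorter
      (_∷_ {d₁} p₁ (_∷_ {d₂} p₂ (_∷_ {d₃} p₃ (_∷_ {d₄} p₄ (_∷_ {d₅} p₅ (_∷_ {d₆} p₆ (_∷_ {d₇} {x = t} p₇ ps))))))) eq =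
      simplex-arith n s (2 ^ r) big n≤2s+1 8s≤N
      where
      ρ : V r → Vec (V r) 9
      ρ x = x ∷ d₁ ∷ d₂ ∷ d₃ ∷ d₄ ∷ d₅ ∷ d₆ ∷ d₇ ∷ t ∷ []
      -- The seven coordinates of (g₁, g₂, g₃) are the seven nonzero vectors of 𝔽₂³, so these words
      -- generate the simplex code. Slot `#8` is the sum t of the other m terms.
      g₁ g₂ g₃ whole : Expr 9
      g₁ = #1 :⊕ #2 :⊕ #3 :⊕ #4
      g₂ = #1 :⊕ #2 :⊕ #5 :⊕ #6
      g₃ = #1 :⊕ #3 :⊕ #5 :⊕ #7
      whole = #1 :⊕ #2 :⊕ #3 :⊕ #4 :⊕ #5 :⊕ #6 :⊕ #7 :⊕ #8
      codeword : V 3 → V r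
      codeword w = comb w (⟦ g₁ ⟧ (ρ 0v) ∷ ⟦ g₂ ⟧ (ρ 0v) ∷ ⟦ g₃ ⟧ (ρ 0v) ∷ [])
      -- Nonzero codewords of the simplex code have weight 4, so replacing four of d₁,…,d₇
      -- by the two elements x and x ⊕ codeword w leaves an odd relation with two terms fewer.
      shorten : ∀ w → w ≢ 0v → ∀ x → x ∈ D A → (x ⊕ codeword w) ∈ D A → ⊥
      shorten (false ∷ false ∷ false ∷ []) w≢0 x q q′ = w≢0 refl
      shorten (true ∷ false ∷ false ∷ []) _ x q q′ =
        shorter (q ∷ q′ ∷ p₅ ∷ p₆ ∷ p₇ ∷ ps)
          (trans (⊕-solve (ρ x) (#0 :⊕ (#0 :⊕ (g₁ :⊕ :0)) :⊕ #5 :⊕ #6 :⊕ #7 :⊕ #8) whole refl) eq)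
      shorten (false ∷ true ∷ false ∷ []) _ x q q′ =
        shorter (q ∷ q′ ∷ p₃ ∷ p₄ ∷ p₇ ∷ ps)
          (trans (⊕-solve (ρ x) (#0 :⊕ (#0 :⊕ (g₂ :⊕ :0)) :⊕ #3 :⊕ #4 :⊕ #7 :⊕ #8) whole refl) eq)
      shorten (true ∷ true ∷ false ∷ []) _ x q q′ =
        shorter (q ∷ q′ ∷ p₁ ∷ p₂ ∷ p₇ ∷ ps)
          (trans (⊕-solve (ρ x) (#0 :⊕ (#0 :⊕ (g₁ :⊕ g₂ :⊕ :0)) :⊕ #1 :⊕ #2 :⊕ #7 :⊕ #8) whole refl) eq)
      shorten (false ∷ false ∷ true ∷ []) _ x q q′ =
        shorter (q ∷ q′ ∷ p₂ ∷ p₄ ∷ p₆ ∷ ps)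
          (trans (⊕-solve (ρ x) (#0 :⊕ (#0 :⊕ (g₃ :⊕ :0)) :⊕ #2 :⊕ #4 :⊕ #6 :⊕ #8) whole refl) eq)
      shorten (true ∷ false ∷ true ∷ []) _ x q q′ =
        shorter (q ∷ q′ ∷ p₁ ∷ p₃ ∷ p₆ ∷ ps)
          (trans (⊕-solve (ρ x) (#0 :⊕ (#0 :⊕ (g₁ :⊕ g₃ :⊕ :0)) :⊕ #1 :⊕ #3 :⊕ #6 :⊕ #8) whole refl) eq)
      shorten (false ∷ true ∷ true ∷ []) _ x q q′ =
        shorter (q ∷ q′ ∷ p₁ ∷ p₄ ∷ p₅ ∷ ps)
          (trans (⊕-solve (ρ x) (#0 :⊕ (#0 :⊕ (g₂ :⊕ g₃ :⊕ :0)) :⊕ #1 :⊕ #4 :⊕ #5 :⊕ #8) whole refl) eq)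
      shorten (true ∷ true ∷ true ∷ []) _ x q q′ =
        shorter (q ∷ q′ ∷ p₂ ∷ p₃ ∷ p₅ ∷ ps)
          (trans (⊕-solve (ρ x) (#0 :⊕ (#0 :⊕ (g₁ :⊕ g₂ :⊕ g₃ :⊕ :0)) :⊕ #2 :⊕ #3 :⊕ #5 :⊕ #8) whole refl) eq)
      disjoint : ∀ g u v → (g ⊕ codeword u) ∈ D A → (g ⊕ codeword v) ∈ D A → u ≡ v
      disjoint g u v q q′ with u ≟ v
      ... | yes e = e
      ... | no u≢v = ⊥-elim (shorten (u ⊕ v) (λ e → u≢v (x⊕y≡0⇒x≡y u v e)) (g ⊕ codeword u) q
        (subst (_∈ D A) (trans
          (⊕-solve (g ∷ codeword u ∷ codeword v ∷ []) (#0 :⊕ #2) ((#0 :⊕ #1) :⊕ #1 :⊕ #2) refl)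
          (cong ((g ⊕ codeword u) ⊕_) (sym (comb-⊕ u v _)))) q′))
      8s≤N : s * 8 ≤ 1 * 2 ^ r
      8s≤N = begin
        s * 8
          ≡⟨ sym (∑-const {3} s) ⟩
        ∑ {3} (λ u → s)
          ≡⟨ ∑-cong (λ u → sym (∑-translate (codeword u) (λ d → ι (D A d)))) ⟩
        ∑ {3} (λ u → ∑ (λ g → ι (D A (g ⊕ codeword u))))
          ≡⟨ ∑-swap {3} (λ u g → ι (D A (g ⊕ codeword u))) ⟩
        ∑ (λ g → ∑ {3} (λ u → ι (D A (g ⊕ codeword u))))
          ≤⟨ ∑-mono (λ g → ∑-atMostOne (λ u → D A (g ⊕ codeword u)) (disjoint g)) ⟩
        ∑ {r} (λ g → 1)
          ≡⟨ ∑-const {r} 1 ⟩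
        1 * 2 ^ r ∎
        where open ≤-Reasoning

    -- Relations with one, three and five terms are treated directly; from seven terms on,
    -- `shorten-relation` descends by two.
    no-odd-relation : ∀ k {x} → SumOf (D A) (suc (dbl k)) x → x ≢ 0v
    no-odd-relation 0 (_∷_ {d} p []) eq = 0∉D (subst (_∈ D A) (trans (sym (⊕-identityʳ d)) eq) p)
    -- In K₄ every vertex set satisfies |S| ≤ 1 + e(S), whence the constants 1, 1, 1. The edge
    -- directions are d₁, d₂ and d₃ = d₁ + d₂.
    no-odd-relation 1 (_∷_ {d₁} p₁ (_∷_ {d₂} p₂ (_∷_ {d₃} p₃ []))) eq =
      triangle-arith n (2 ^ r) big (averaged-bound A (d₁ ∷ d₂ ∷ [])
        (generators (p₁ ∷ p₂ ∷ []) (subst (_∈ D A) (sym last) p₃)) 1 1 1 (allV 2) refl)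
      where
      last : d₁ ⊕ (d₂ ⊕ 0v) ≡ d₃
      last = x⊕y≡0⇒x≡y _ _ (trans
        (⊕-solve (d₁ ∷ d₂ ∷ d₃ ∷ []) ((#0 :⊕ #1 :⊕ :0) :⊕ #2) (#0 :⊕ #1 :⊕ #2 :⊕ :0) refl) eq)
    -- 4|S| ≤ 20 + 3 e(S) for every set S of vertices of the Clebsch graph; the constants fit independent 5-sets
    -- and 8-sets spanning 4 edges.
    no-odd-relation 2 (_∷_ {d₁} p₁ (_∷_ {d₂} p₂ (_∷_ {d₃} p₃ (_∷_ {d₄} p₄ (_∷_ {d₅} p₅ []))))) eq =
      pentagon-arith r n big (2n≤N+2 p₁) (averaged-bound A (d₁ ∷ d₂ ∷ d₃ ∷ d₄ ∷ [])
        (generators (p₁ ∷ p₂ ∷ p₃ ∷ p₄ ∷ []) (subst (_∈ D A) (sym last) p₅)) 4 3 20 (allV 4) refl)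
      where
      last : d₁ ⊕ (d₂ ⊕ (d₃ ⊕ (d₄ ⊕ 0v))) ≡ d₅
      last = x⊕y≡0⇒x≡y _ _ (trans
        (⊕-solve (d₁ ∷ d₂ ∷ d₃ ∷ d₄ ∷ d₅ ∷ []) ((#0 :⊕ #1 :⊕ #2 :⊕ #3 :⊕ :0) :⊕ #4)
          (#0 :⊕ #1 :⊕ #2 :⊕ #3 :⊕ #4 :⊕ :0) refl) eq)
    no-odd-relation (suc k@(suc (suc _))) t eq = shorten-relation (no-odd-relation k) t eq

    bipartition : ∃[ φ ] (∀ d → d ∈ D A → dot φ d ≡ true)
    bipartition with affine-alternative (λ d b → D A d ∧ b)
    ... | inj₁ (φ , sol) = φ , λ d h → sol d true (trans (Bool.∧-identityʳ (D A d)) h)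
    ... | inj₂ g with Gen⇒SumOf g
    ...   | m , t , odd with isOdd⇒≡1+dbl m odd
    ...     | k , refl = ⊥-elim (no-odd-relation k t refl)

-- The graph of unique sums

-- The three bounds add up to 3n ≤ 2M + 5, against 3n ≥ 2M + 10. Each degree is written as a
-- successor, so that kᵢ is the surplus over the one edge already counted at every vertex.
disjoint-edges-arith : ∀ n s M k₁ k₂ k₃ k₄ → M + M + 10 ≤ 3 * n →
  n + s ≤ M + (suc k₁ + suc k₂) → n + s ≤ M + (suc k₃ + suc k₄) →
  n + (k₁ + k₂ + (k₃ + k₄)) ≤ 2 * s + 1 → ⊥
disjoint-edges-arith n s M k₁ k₂ k₃ k₄ h₀ h₁ h₂ h₃ = m+1+n≰m (2 * M + (2 * s + (k₁ + k₂ + k₃ + k₄)) + 5) {4} (begin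
  2 * M + (2 * s + (k₁ + k₂ + k₃ + k₄)) + 5 + suc 4
    ≡⟨ e₁ M s k₁ k₂ k₃ k₄ ⟩
  (M + M + 10) + (2 * s + (k₁ + k₂ + k₃ + k₄))
    ≤⟨ +-monoˡ-≤ _ h₀ ⟩
  3 * n + (2 * s + (k₁ + k₂ + k₃ + k₄))
    ≡⟨ e₂ n s k₁ k₂ k₃ k₄ ⟩
  (n + s) + ((n + s) + (n + (k₁ + k₂ + (k₃ + k₄))))
    ≤⟨ +-mono-≤ h₁ (+-mono-≤ h₂ h₃) ⟩
  (M + (suc k₁ + suc k₂)) + ((M + (suc k₃ + suc k₄)) + (2 * s + 1))
    ≡⟨ e₃ M s k₁ k₂ k₃ k₄ ⟩
  2 * M + (2 * s + (k₁ + k₂ + k₃ + k₄)) + 5 ∎)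
  where
  open ≤-Reasoning
  e₁ : ∀ M s k₁ k₂ k₃ k₄ → 2 * M + (2 * s + (k₁ + k₂ + k₃ + k₄)) + 5 + suc 4 ≡
    (M + M + 10) + (2 * s + (k₁ + k₂ + k₃ + k₄))
  e₁ = solve-∀
  e₂ : ∀ n s k₁ k₂ k₃ k₄ → 3 * n + (2 * s + (k₁ + k₂ + k₃ + k₄)) ≡
    (n + s) + ((n + s) + (n + (k₁ + k₂ + (k₃ + k₄))))
  e₂ = solve-∀
  e₃ : ∀ M s k₁ k₂ k₃ k₄ → (M + (suc k₁ + suc k₂)) + ((M + (suc k₃ + suc k₄)) + (2 * s + 1)) ≡
    2 * M + (2 * s + (k₁ + k₂ + k₃ + k₄)) + 5
  e₃ = solve-∀

module Covered {r} (A : Subset₂ r) (big : 2 ^ r + 10 ≤ 3 * ∑ (λ x → ι (A x)))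
  (cover : ∀ x → x ∈ A → x ≢ 0v → ∃[ y ] (y ∈ A × (x ⊕ y) ∈ D A)) where

  open Large A big

  -- Edges at x are indexed by their sum d, the other end being d + x; in this form they appear in
  -- `edge-inequality`.
  degree : V r → ℕ
  degree x = ∑ (λ d → ι (D A d) * ι (A (d ⊕ x)))

  -- The handshake count: each d in D comes from two ordered pairs.
  ∑-degree : ∑ (λ x → ι (A x) * degree x) ≡ 2 * s
  ∑-degree = begin
    ∑ (λ x → ι (A x) * degree x)
      ≡⟨ ∑-cong (λ x → sym (∑-*ˡ (ι (A x)) (λ d → ι (D A d) * ι (A (d ⊕ x))))) ⟩
    ∑ (λ x → ∑ (λ d → ι (A x) * (ι (D A d) * ι (A (d ⊕ x)))))
      ≡⟨ ∑-swap (λ x d → ι (A x) * (ι (D A d) * ι (A (d ⊕ x)))) ⟩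
    ∑ (λ d → ∑ (λ x → ι (A x) * (ι (D A d) * ι (A (d ⊕ x)))))
      ≡⟨ ∑-cong (λ d → ∑-cong (λ x → trans
           (cong (λ t → ι (A x) * (ι (D A d) * ι (A t))) (⊕-comm d x))
           (commute (ι (A x)) (ι (D A d)) (ι (A (x ⊕ d)))))) ⟩
    ∑ (λ d → ∑ (λ x → ι (D A d) * (ι (A x) * ι (A (x ⊕ d)))))
      ≡⟨ ∑-cong (λ d → trans (∑-*ˡ (ι (D A d)) (λ x → ι (A x) * ι (A (x ⊕ d)))) (twice d)) ⟩
    ∑ (λ d → 2 * ι (D A d))
      ≡⟨ ∑-*ˡ 2 (λ d → ι (D A d)) ⟩
    2 * s ∎
    where
    open ≡-Reasoning
    commute : ∀ a b c → a * (b * c) ≡ b * (a * c)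
    commute = solve-∀
    twice : ∀ d → ι (D A d) * rep A d ≡ 2 * ι (D A d)
    twice d with D A d in eq
    ... | true = trans (*-identityˡ (rep A d)) (D⇒rep≡2 A eq)
    ... | false = refl

  1≤degree : ∀ {x y} → y ∈ A → (x ⊕ y) ∈ D A → 1 ≤ degree x
  1≤degree {x} {y} y∈A xy∈D = ≤-trans
    (≤-reflexive (sym (cong₂ (λ a b → ι a * ι b) xy∈D (trans (cong A ([x⊕y]⊕x≡y x y)) y∈A))))
    (term≤∑ (λ d → ι (D A d) * ι (A (d ⊕ x))) (x ⊕ y))

  -- The indicator pays for 0, the one vertex that may be isolated, and becomes the 1 in `n≤2s+1`.
  ι≤degree : ∀ x → ι (A x) ≤ ι (A x) * degree x + [ x ＝ 0v ]
  ι≤degree x with A x in x∈A | x ≟ 0v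
  ... | false | _ = z≤n
  ... | true | yes _ = m≤n+m 1 _
  ... | true | no x≢0 with cover x x∈A x≢0
  ...   | y , y∈A , xy∈D = ≤-trans (1≤degree y∈A xy∈D)
    (≤-reflexive (sym (trans (+-identityʳ _) (*-identityˡ (degree x)))))

  ∑-upper : ∑ (λ x → ι (A x) * degree x + [ x ＝ 0v ]) ≡ 2 * s + 1
  ∑-upper = trans (∑-+ (λ x → ι (A x) * degree x) (λ x → [ x ＝ 0v ]))
    (cong₂ _+_ ∑-degree (∑-point {r} 0v))

  n≤2s+1 : n ≤ 2 * s + 1
  n≤2s+1 = ≤-trans (∑-mono ι≤degree) (≤-reflexive ∑-upper)

  module _ (φ : V r) (χ-D : ∀ d → d ∈ D A → dot φ d ≡ true) where

    χ : V r → Bool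
    χ = dot φ

    M : ℕ
    M = ∑ (λ z → ι (χ z))

    -- Translation by d exchanges the cosets χ = 0 and χ = 1.
    M+M≡N : ∀ {d} → d ∈ D A → M + M ≡ 2 ^ r
    M+M≡N {d} h = begin
      M + M                                     ≡⟨ cong (M +_) (sym (∑-translate d (λ z → ι (χ z)))) ⟩
      M + ∑ (λ z → ι (χ (z ⊕ d)))               ≡⟨ sym (∑-+ (λ z → ι (χ z)) (λ z → ι (χ (z ⊕ d)))) ⟩
      ∑ (λ z → ι (χ z) + ι (χ (z ⊕ d)))         ≡⟨ ∑-cong one ⟩
      ∑ {r} (λ _ → 1)                           ≡⟨ trans (∑-const {r} 1) (*-identityˡ (2 ^ r)) ⟩
      2 ^ r                                     ∎
      where
      open ≡-Reasoning
      one : ∀ z → ι (χ z) + ι (χ (z ⊕ d)) ≡ 1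
      one z rewrite dot-⊕ φ z d | χ-D d h with χ z
      ... | true = refl
      ... | false = refl

    -- In the coset χ = 1 the translates of the two halves of A by y and by x meet only in x ⊕ y,
    -- and D avoids both apart from the edges at x and at y.
    edge-inequality : ∀ {x y} → x ∈ A → y ∈ A → (x ⊕ y) ∈ D A → n + s ≤ M + (degree x + degree y)
    edge-inequality {x} {y} x∈A y∈A xy∈D = begin
      n + s
        ≡⟨ cong (_+ s) (sym halves) ⟩
      ∑ half-x + ∑ half-y + s
        ≡⟨ cong (_+ s) (sym (∑-+ half-x half-y)) ⟩
      ∑ (λ z → half-x z + half-y z) + s
        ≡⟨ sym (∑-+ (λ z → half-x z + half-y z) (λ z → ι (D A z))) ⟩
      ∑ (λ z → half-x z + half-y z + ι (D A z))
        ≤⟨ ∑-mono below ⟩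
      ∑ (λ z → ι (χ z) + (ι (D A z) * ι (A (z ⊕ x)) + ι (D A z) * ι (A (z ⊕ y))))
        ≡⟨ ∑-+ (λ z → ι (χ z)) (λ z → ι (D A z) * ι (A (z ⊕ x)) + ι (D A z) * ι (A (z ⊕ y))) ⟩
      M + ∑ (λ z → ι (D A z) * ι (A (z ⊕ x)) + ι (D A z) * ι (A (z ⊕ y)))
        ≡⟨ cong (M +_) (∑-+ (λ z → ι (D A z) * ι (A (z ⊕ x))) (λ z → ι (D A z) * ι (A (z ⊕ y)))) ⟩
      M + (degree x + degree y) ∎
      where
      open ≤-Reasoning
      half-x half-y : V r → ℕ
      half-x z = ι (χ z) * ι (A (z ⊕ x))
      half-y z = ι (χ z) * ι (A (z ⊕ y))
      shift : ∀ p → ∑ (λ z → ι (χ z) * ι (A (z ⊕ p))) ≡ ∑ (λ z → ι (χ z xor χ p) * ι (A z))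
      shift p = trans
        (∑-cong (λ z → cong (λ t → ι t * ι (A (z ⊕ p)))
          (trans (cong χ (sym ([x⊕y]⊕y≡x z p))) (dot-⊕ φ (z ⊕ p) p))))
        (∑-translate p (λ z → ι (χ z xor χ p) * ι (A z)))
      split : ∀ a b c e → b xor c ≡ true → ι (a xor b) * e + ι (a xor c) * e ≡ e
      split false false true e _ = +-identityʳ e
      split false true false e _ = trans (+-identityʳ _) (+-identityʳ e)
      split true false true e _ = trans (+-identityʳ _) (+-identityʳ e)
      split true true false e _ = +-identityʳ e
      -- Since χ x ≠ χ y, translation by x and by y carries the coset χ = 1 onto the two different
      -- cosets of χ, so each element of A is counted once.
      halves : ∑ half-x + ∑ half-y ≡ n
      halves = trans (cong₂ _+_ (shift x) (shift y)) (trans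
        (sym (∑-+ (λ z → ι (χ z xor χ x) * ι (A z)) (λ z → ι (χ z xor χ y) * ι (A z))))
        (∑-cong (λ z → split (χ z) (χ x) (χ y) (ι (A z)) (trans (sym (dot-⊕ φ x y)) (χ-D _ xy∈D)))))
      χ0 : χ 0v ≡ false
      χ0 = trans (cong χ (sym (⊕-self 0v))) (trans (dot-⊕ φ 0v 0v) (Bool.xor-same (χ 0v)))
      -- The elements z + x and z + y have sum x + y, so z + x is x or y. The first would give z =
      -- 0, where χ vanishes; the second gives z = x + y.
      collision : ∀ z → χ z ≡ true → (z ⊕ x) ∈ A → (z ⊕ y) ∈ A → z ∈ D A
      collision z χz p q with edge-unique x∈A y∈A xy∈D p q
        (⊕-solve (z ∷ x ∷ y ∷ []) ((#0 :⊕ #1) :⊕ #0 :⊕ #2) (#1 :⊕ #2) refl)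
      ... | inj₁ e = ⊥-elim (Bool.not-¬ χz (trans (cong χ z≡0) χ0))
        where
        z≡0 : z ≡ 0v
        z≡0 = trans (sym ([x⊕y]⊕y≡x z x)) (trans (cong (_⊕ x) e) (⊕-self x))
      ... | inj₂ e = subst (_∈ D A) (trans (cong (x ⊕_) (sym e))
        (⊕-solve (z ∷ x ∷ []) (#1 :⊕ #0 :⊕ #1) #0 refl)) xy∈D
      below : ∀ z → half-x z + half-y z + ι (D A z) ≤
        ι (χ z) + (ι (D A z) * ι (A (z ⊕ x)) + ι (D A z) * ι (A (z ⊕ y)))
      below z with D A z in z∈D | χ z in χz
      ... | true | false with () ← trans (sym (χ-D z z∈D)) χz
      ... | true | true = ≤-reflexive (+-comm _ 1)
      ... | false | false = z≤n
      ... | false | true with A (z ⊕ x) in p | A (z ⊕ y) in q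
      ...   | false | false = z≤n
      ...   | false | true = ≤-refl
      ...   | true | false = ≤-refl
      ...   | true | true with () ← trans (sym (collision z χz p q)) z∈D

    -- The four ends are distinct, so their surplus degrees can all be added to the bound n ≤ 2s +
    -- 1. This is played off against `edge-inequality` for both edges.
    bipartite⇒no-disjoint-edges : ∀ {x y x′ y′} → x ∈ A → y ∈ A → (x ⊕ y) ∈ D A →
      x′ ∈ A → y′ ∈ A → (x′ ⊕ y′) ∈ D A →
      x ≢ x′ → x ≢ y′ → y ≢ x′ → y ≢ y′ → ⊥
    bipartite⇒no-disjoint-edges {x} {y} {x′} {y′} x∈A y∈A xy∈D x′∈A y′∈A xy′∈D x≢x′ x≢y′ y≢x′ y≢y′
      with m≤n⇒∃[o]m+o≡n (1≤degree {x} y∈A xy∈D)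
         | m≤n⇒∃[o]m+o≡n (1≤degree {y} x∈A (subst (_∈ D A) (⊕-comm x y) xy∈D))
         | m≤n⇒∃[o]m+o≡n (1≤degree {x′} y′∈A xy′∈D)
         | m≤n⇒∃[o]m+o≡n (1≤degree {y′} x′∈A (subst (_∈ D A) (⊕-comm x′ y′) xy′∈D))
    ... | k₁ , e₁ | k₂ , e₂ | k₃ , e₃ | k₄ , e₄ =
      disjoint-edges-arith n s M k₁ k₂ k₃ k₄
        (subst (λ t → t + 10 ≤ 3 * n) (sym (M+M≡N xy∈D)) big)
        (subst₂ (λ a b → n + s ≤ M + (a + b)) (sym e₁) (sym e₂) (edge-inequality x∈A y∈A xy∈D))
        (subst₂ (λ a b → n + s ≤ M + (a + b)) (sym e₃) (sym e₄) (edge-inequality x′∈A y′∈A xy′∈D))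
        (≤-trans (≤-reflexive total) (≤-trans (∑-mono below) (≤-reflexive ∑-upper)))
      where
      extra : V r → ℕ
      extra z = k₁ * [ z ＝ x ] + k₂ * [ z ＝ y ] + (k₃ * [ z ＝ x′ ] + k₄ * [ z ＝ y′ ])
      ∑-at : ∀ k p → ∑ (λ z → k * [ z ＝ p ]) ≡ k
      ∑-at k p = trans (∑-*ˡ k (λ z → [ z ＝ p ])) (trans (cong (k *_) (∑-point p)) (*-identityʳ k))
      ∑-two : ∀ k p k′ p′ → ∑ (λ z → k * [ z ＝ p ] + k′ * [ z ＝ p′ ]) ≡ k + k′
      ∑-two k p k′ p′ = trans (∑-+ (λ z → k * [ z ＝ p ]) (λ z → k′ * [ z ＝ p′ ]))
        (cong₂ _+_ (∑-at k p) (∑-at k′ p′))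
      total : n + (k₁ + k₂ + (k₃ + k₄)) ≡ ∑ (λ z → ι (A z) + extra z)
      total = sym (trans (∑-+ (λ z → ι (A z)) extra) (cong (n +_)
        (trans (∑-+ (λ z → k₁ * [ z ＝ x ] + k₂ * [ z ＝ y ]) (λ z → k₃ * [ z ＝ x′ ] + k₄ * [ z ＝ y′ ]))
          (cong₂ _+_ (∑-two k₁ x k₂ y) (∑-two k₃ x′ k₄ y′)))))
      at : ∀ {p k l} → p ∈ A → 1 + k ≡ degree p → l ≡ k → ι (A p) + l ≤ ι (A p) * degree p + [ p ＝ 0v ]
      at p∈A e refl rewrite p∈A | sym e = ≤-trans (≤-reflexive (sym (+-identityʳ _))) (m≤m+n _ _)
      l₁ : ∀ a b c d → a * 1 + b * 0 + (c * 0 + d * 0) ≡ a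
      l₁ = solve-∀
      l₂ : ∀ a b c d → a * 0 + b * 1 + (c * 0 + d * 0) ≡ b
      l₂ = solve-∀
      l₃ : ∀ a b c d → a * 0 + b * 0 + (c * 1 + d * 0) ≡ c
      l₃ = solve-∀
      l₄ : ∀ a b c d → a * 0 + b * 0 + (c * 0 + d * 1) ≡ d
      l₄ = solve-∀
      l₀ : ∀ a b c d → a * 0 + b * 0 + (c * 0 + d * 0) ≡ 0
      l₀ = solve-∀
      below : ∀ z → ι (A z) + extra z ≤ ι (A z) * degree z + [ z ＝ 0v ]
      below z with z ≟ x | z ≟ y | z ≟ x′ | z ≟ y′
      ... | yes refl | no _ | no _ | no _ = at x∈A e₁ (l₁ k₁ k₂ k₃ k₄)
      ... | no _ | yes refl | no _ | no _ = at y∈A e₂ (l₂ k₁ k₂ k₃ k₄)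
      ... | no _ | no _ | yes refl | no _ = at x′∈A e₃ (l₃ k₁ k₂ k₃ k₄)
      ... | no _ | no _ | no _ | yes refl = at y′∈A e₄ (l₄ k₁ k₂ k₃ k₄)
      ... | no _ | no _ | no _ | no _ = ≤-trans
        (≤-reflexive (trans (cong (ι (A z) +_) (l₀ k₁ k₂ k₃ k₄)) (+-identityʳ _))) (ι≤degree z)
      ... | yes p | yes q | _ | _ = ⊥-elim (edge-distinct xy∈D (trans (sym p) q))
      ... | yes p | no _ | yes q | _ = ⊥-elim (x≢x′ (trans (sym p) q))
      ... | yes p | no _ | no _ | yes q = ⊥-elim (x≢y′ (trans (sym p) q))
      ... | no _ | yes p | yes q | _ = ⊥-elim (y≢x′ (trans (sym p) q))
      ... | no _ | yes p | no _ | yes q = ⊥-elim (y≢y′ (trans (sym p) q))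
      ... | no _ | no _ | yes p | yes q = ⊥-elim (edge-distinct xy′∈D (trans (sym p) q))

  no-disjoint-edges : ∀ {x y x′ y′} → x ∈ A → y ∈ A → (x ⊕ y) ∈ D A →
    x′ ∈ A → y′ ∈ A → (x′ ⊕ y′) ∈ D A →
    x ≢ x′ → x ≢ y′ → y ≢ x′ → y ≢ y′ → ⊥
  no-disjoint-edges with bipartition n≤2s+1
  ... | φ , χ-D = bipartite⇒no-disjoint-edges φ χ-D

∈D-intro : ∀ {r} (A : Subset₂ r) {x y} → x ∈ A → y ∈ A → x ≢ y →
  (∀ z w → z ∈ A → w ∈ A → z ⊕ w ≡ x ⊕ y → z ≡ x ⊎ z ≡ y) → (x ⊕ y) ∈ D A
∈D-intro {r} A {x} {y} x∈A y∈A x≢y unique = cong (_≡ᵇ 2) (begin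
  rep A (x ⊕ y)                                    ≡⟨ ∑-cong pointwise ⟩
  ∑ (λ z → [ z ＝ x ] + [ z ＝ y ])                ≡⟨ ∑-+ (λ z → [ z ＝ x ]) (λ z → [ z ＝ y ]) ⟩
  ∑ (λ z → [ z ＝ x ]) + ∑ (λ z → [ z ＝ y ])      ≡⟨ cong₂ _+_ (∑-point x) (∑-point y) ⟩
  2                                                ∎)
  where
  open ≡-Reasoning
  pointwise : ∀ z → ι (A z) * ι (A (z ⊕ (x ⊕ y))) ≡ [ z ＝ x ] + [ z ＝ y ]
  pointwise z with z ≟ x | z ≟ y
  ... | yes refl | yes refl = ⊥-elim (x≢y refl)
  ... | yes refl | no _ = cong₂ (λ a b → ι a * ι b) x∈A (trans (cong A (x⊕[x⊕y]≡y x y)) y∈A)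
  ... | no _ | yes refl = cong₂ (λ a b → ι a * ι b) y∈A
    (trans (cong A (trans (cong (y ⊕_) (⊕-comm x y)) (x⊕[x⊕y]≡y y x))) x∈A)
  ... | no z≢x | no z≢y with A z in p | A (z ⊕ (x ⊕ y)) in q
  ...   | false | _ = refl
  ...   | true | false = refl
  ...   | true | true = ⊥-elim ([ z≢x , z≢y ]′ (unique z _ p q (x⊕[x⊕y]≡y z (x ⊕ y))))

pick : ∀ {r} (A : Subset₂ r) → 4 ≤ ∑ (λ x → ι (A x)) →
  ∀ p q s → ∃[ a ] (a ∈ A × a ≢ p × a ≢ q × a ≢ s)
pick {r} A 4≤n p q s
  with any? (λ a → (A a Bool.≟ true) ×-dec ¬? (a ≟ p) ×-dec ¬? (a ≟ q) ×-dec ¬? (a ≟ s))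
... | yes found = found
... | no ¬∃ = ⊥-elim (1+n≰n (≤-trans 4≤n (begin
  ∑ (λ x → ι (A x))
    ≤⟨ ∑-mono below ⟩
  ∑ (λ x → [ x ＝ p ] + ([ x ＝ q ] + [ x ＝ s ]))
    ≡⟨ trans (∑-+ (λ x → [ x ＝ p ]) _) (cong (∑ (λ x → [ x ＝ p ]) +_) (∑-+ (λ x → [ x ＝ q ]) _)) ⟩
  ∑ (λ x → [ x ＝ p ]) + (∑ (λ x → [ x ＝ q ]) + ∑ (λ x → [ x ＝ s ]))
    ≡⟨ cong₂ _+_ (∑-point p) (cong₂ _+_ (∑-point q) (∑-point s)) ⟩
  3 ∎)))
  where
  open ≤-Reasoning
  below : ∀ x → ι (A x) ≤ [ x ＝ p ] + ([ x ＝ q ] + [ x ＝ s ])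
  below x with A x in x∈A | x ≟ p | x ≟ q | x ≟ s
  ... | false | _ | _ | _ = z≤n
  ... | true | yes _ | _ | _ = s≤s z≤n
  ... | true | no _ | yes _ | _ = s≤s z≤n
  ... | true | no _ | no _ | yes _ = s≤s z≤n
  ... | true | no x≢p | no x≢q | no x≢s = ⊥-elim (¬∃ (x , x∈A , x≢p , x≢q , x≢s))

big⇒4≤n : ∀ N n → N + 10 ≤ 3 * n → 4 ≤ n
big⇒4≤n N n big with 4 ≤? n
... | yes p = p
... | no ¬p = ⊥-elim (≤⇒≤ᵇ (≤-trans (m≤n+m 10 N) (≤-trans big (*-monoʳ-≤ 3 (≤-pred (≰⇒> ¬p))))))

-- From pairwise meeting edges to a star

module Star {r} (A : Subset₂ r) (big : 2 ^ r + 10 ≤ 3 * ∑ (λ x → ι (A x))) (0∈A : 0v ∈ A)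
  (cover : ∀ x → x ∈ A → x ≢ 0v → ∃[ y ] (y ∈ A × (x ⊕ y) ∈ D A)) where

  open Large A big
  open Covered A big cover

  Edge : V r → V r → Set
  Edge x y = x ∈ A × y ∈ A × (x ⊕ y) ∈ D A

  Edge-sym : ∀ {x y} → Edge x y → Edge y x
  Edge-sym {x} {y} (p , q , h) = q , p , subst (_∈ D A) (⊕-comm x y) h

  edges-meet : ∀ {b b′ c p} → Edge b b′ → Edge c p → b ≢ c → b ≢ p → b′ ≡ c ⊎ b′ ≡ p
  edges-meet {b} {b′} {c} {p} (b∈A , b′∈A , bb′) (c∈A , p∈A , cp) b≢c b≢p with b′ ≟ c | b′ ≟ p
  ... | yes e | _ = inj₁ e
  ... | no _ | yes e = inj₂ e
  ... | no b′≢c | no b′≢p = ⊥-elim (no-disjoint-edges b∈A b′∈A bb′ c∈A p∈A cp b≢c b≢p b′≢c b′≢p)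

  IsCentre : V r → Set
  IsCentre c = c ∈ A × (∀ a → a ∈ A → a ≢ c → (c ⊕ a) ∈ D A)

  -- An edge at a further vertex b ≠ 0 has to meet both cp and cq. Its other end cannot be p and q
  -- at once, so it is c.
  two-edges⇒centre : ∀ {c p q} → Edge c p → Edge c q → p ≢ q → IsCentre c
  two-edges⇒centre {c} {p} {q} ecp@(c∈A , _ , cp) ecq@(_ , _ , cq) p≢q = c∈A , joined
    where
    joined≢0 : ∀ b → b ∈ A → b ≢ 0v → b ≢ c → (c ⊕ b) ∈ D A
    joined≢0 b b∈A b≢0 b≢c with b ≟ p | b ≟ q | cover b b∈A b≢0
    ... | yes refl | _ | _ = cp
    ... | no _ | yes refl | _ = cq
    ... | no b≢p | no b≢q | b′ , b′∈A , bb′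
      with edges-meet (b∈A , b′∈A , bb′) ecp b≢c b≢p | edges-meet (b∈A , b′∈A , bb′) ecq b≢c b≢q
    ...   | inj₁ refl | _ = subst (_∈ D A) (⊕-comm b c) bb′
    ...   | inj₂ _ | inj₁ refl = subst (_∈ D A) (⊕-comm b c) bb′
    ...   | inj₂ refl | inj₂ e = ⊥-elim (p≢q e)
    joined : ∀ a → a ∈ A → a ≢ c → (c ⊕ a) ∈ D A
    joined a a∈A a≢c with a ≟ 0v
    ... | no a≢0 = joined≢0 a a∈A a≢0 a≢c
    -- If c = z + w were a second representation, then c + z = w + 0 would contradict
    -- the uniqueness of c + z.
    ... | yes refl = ∈D-intro A c∈A 0∈A (≢-sym a≢c) unique
      where
      unique : ∀ z w → z ∈ A → w ∈ A → z ⊕ w ≡ c ⊕ 0v → z ≡ c ⊎ z ≡ 0v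
      unique z w z∈A w∈A eq with z ≟ c | z ≟ 0v
      ... | yes e | _ = inj₁ e
      ... | no _ | yes e = inj₂ e
      ... | no z≢c | no z≢0 = ⊥-elim ([ a≢c , (λ e → z≢0 (sym e)) ]′
        (edge-unique c∈A z∈A (joined≢0 z z∈A z≢0 z≢c) 0∈A w∈A (begin
          0v ⊕ w            ≡⟨ ⊕-solve (z ∷ w ∷ []) (:0 :⊕ #1) ((#0 :⊕ #1) :⊕ #0) refl ⟩
          (z ⊕ w) ⊕ z       ≡⟨ cong (_⊕ z) eq ⟩
          (c ⊕ 0v) ⊕ z      ≡⟨ cong (_⊕ z) (⊕-identityʳ c) ⟩
          c ⊕ z             ∎)))
        where open ≡-Reasoning

  star : ∃ IsCentre
  -- Start from any edge xy and a vertex a other than 0, x, y. The edge at a must end in x or y, and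
  -- that end then carries two edges.
  star with pick A (big⇒4≤n (2 ^ r) n big) 0v 0v 0v
  ... | x , x∈A , x≢0 , _ with cover x x∈A x≢0
  ... | y , y∈A , xy with pick A (big⇒4≤n (2 ^ r) n big) 0v x y
  ... | a , a∈A , a≢0 , a≢x , a≢y with cover a a∈A a≢0
  ... | a′ , a′∈A , aa′ with edges-meet (a∈A , a′∈A , aa′) (x∈A , y∈A , xy) a≢x a≢y
  ... | inj₁ refl = x , two-edges⇒centre (x∈A , y∈A , xy) (Edge-sym (a∈A , a′∈A , aa′)) (≢-sym a≢y)
  ... | inj₂ refl = y , two-edges⇒centre (Edge-sym (x∈A , y∈A , xy)) (Edge-sym (a∈A , a′∈A , aa′)) (≢-sym a≢x)

-- Saturating sets and sum-free sets

_∪0 : ∀ {r} → Subset₂ r → Subset₂ r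
(A ∪0) x = A x ∨ does (x ≟ 0v)

∪0-split : ∀ {r} (A : Subset₂ r) {x} → x ∈ (A ∪0) → x ∈ A ⊎ x ≡ 0v
∪0-split A {x} h with A x | x ≟ 0v
... | true | _ = inj₁ refl
... | false | yes e = inj₂ e

∪0-join : ∀ {r} (A : Subset₂ r) {x} → x ∈ A ⊎ x ≡ 0v → x ∈ (A ∪0)
∪0-join A (inj₁ p) = ∨-introˡ p
∪0-join {r} A (inj₂ refl) = ∨-introʳ {A 0v} (dec-true (0v {r} ≟ 0v) refl)

∪0-intro : ∀ {r} (A : Subset₂ r) {x} → (x ≢ 0v → x ∈ A) → x ∈ (A ∪0)
∪0-intro A {x} h = ∪0-join A (by-cases (x ≟ 0v))
  where
  by-cases : Dec (x ≡ 0v) → x ∈ A ⊎ x ≡ 0v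
  by-cases (yes e) = inj₂ e
  by-cases (no x≢0) = inj₁ (h x≢0)

∪0-≢0 : ∀ {r} (A : Subset₂ r) {x} → x ∈ (A ∪0) → x ≢ 0v → x ∈ A
∪0-≢0 A h x≢0 = [ (λ p → p) , (λ e → ⊥-elim (x≢0 e)) ]′ (∪0-split A h)

_∖_ : ∀ {r} → Subset₂ r → V r → Subset₂ r
(A ∖ a) x = A x ∧ not (does (x ≟ a))

∖-split : ∀ {r} (A : Subset₂ r) {a x} → x ∈ (A ∖ a) → x ∈ A × x ≢ a
∖-split A {a} {x} h with A x | x ≟ a
... | true | no x≢a = refl , x≢a

∖-join : ∀ {r} (A : Subset₂ r) {a x} → x ∈ A → x ≢ a → x ∈ (A ∖ a)
∖-join A {a} {x} x∈A x≢a = cong₂ (λ b c → b ∧ not c) x∈A (dec-false (x ≟ a) x≢a)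

∑-∪0 : ∀ {r} (A : Subset₂ r) → AvoidsZero A → ∑ (λ x → ι ((A ∪0) x)) ≡ card A + 1
∑-∪0 {r} A 0∉A = begin
  ∑ (λ x → ι ((A ∪0) x))                      ≡⟨ ∑-cong pointwise ⟩
  ∑ (λ x → ι (A x) + [ x ＝ 0v ])             ≡⟨ ∑-+ (λ x → ι (A x)) (λ x → [ x ＝ 0v ]) ⟩
  ∑ (λ x → ι (A x)) + ∑ {r} (λ x → [ x ＝ 0v ])   ≡⟨ cong₂ _+_ (sym (card≡∑ A)) (∑-point {r} 0v) ⟩
  card A + 1                                  ∎
  where
  open ≡-Reasoning
  pointwise : ∀ x → ι ((A ∪0) x) ≡ ι (A x) + [ x ＝ 0v ]
  pointwise x with A x in x∈A | x ≟ 0v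
  ... | true | yes refl = ⊥-elim (0∉A x∈A)
  ... | true | no _ = refl
  ... | false | yes _ = refl
  ... | false | no _ = refl

_∈2?_ : ∀ {r} (x : V r) (X : Subset₂ r) → Dec (x ∈2 X)
x ∈2? X = any? (λ u → any? (λ v → (X u Bool.≟ true) ×-dec (X v Bool.≟ true) ×-dec (x ≟ u ⊕ v)))

SumFree⇒0∉ : ∀ {r} {S : Subset₂ r} → SumFree S → ¬ (0v ∈ S)
SumFree⇒0∉ sf h = sf 0v h (0v , 0v , h , h , sym (⊕-self 0v))

-- Adjoining 0 turns x ∈ A into the sum x + 0, so saturation makes A ∪ {0} an additive basis of
-- order two.
saturating-basis : ∀ {r} {A : Subset₂ r} → Saturating A →
  ∀ x → ∃[ p ] ∃[ q ] (p ∈ (A ∪0) × q ∈ (A ∪0) × x ≡ p ⊕ q)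
saturating-basis {A = A} (_ , sat) x with sat x
... | inj₁ x∈A = x , 0v , ∪0-join A (inj₁ x∈A) , ∪0-join A (inj₂ refl) , sym (⊕-identityʳ x)
... | inj₂ (p , q , p∈A , q∈A , eq) = p , q , ∪0-join A (inj₁ p∈A) , ∪0-join A (inj₁ q∈A) , eq

basis-saturating : ∀ {r} {A : Subset₂ r} → AvoidsZero A → ∃ (_∈ A) →
  (∀ x → ∃[ p ] ∃[ q ] (p ∈ (A ∪0) × q ∈ (A ∪0) × x ≡ p ⊕ q)) → Saturating A
basis-saturating {A = A} 0∉A (e , e∈A) basis = 0∉A , sat
  where
  sat : ∀ x → x ∈ A ⊎ x ∈2 A
  sat x with basis x
  ... | p , q , p∈ , q∈ , eq with ∪0-split A p∈ | ∪0-split A q∈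
  ...   | inj₁ p∈A | inj₁ q∈A = inj₂ (p , q , p∈A , q∈A , eq)
  ...   | inj₁ p∈A | inj₂ refl = inj₁ (subst (_∈ A) (sym (trans eq (⊕-identityʳ p))) p∈A)
  ...   | inj₂ refl | inj₁ q∈A = inj₁ (subst (_∈ A) (sym (trans eq (⊕-identityˡ q))) q∈A)
  -- Here x = 0, and 0 + 0 is replaced by e + e.
  ...   | inj₂ refl | inj₂ refl = inj₂ (e , e , e∈A , e∈A , trans eq (trans (⊕-self 0v) (sym (⊕-self e))))

-- Without a the set no longer saturates, so some x is left uncovered. Every representation of x in
-- A ∪ {0} then involves a, which makes x = a + y its only one.
minimal⇒cover : ∀ {r} (A : Subset₂ r) → MinimalSaturating A → 4 ≤ ∑ (λ x → ι ((A ∪0) x)) →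
  ∀ a → a ∈ (A ∪0) → a ≢ 0v → ∃[ y ] (y ∈ (A ∪0) × (a ⊕ y) ∈ D (A ∪0))
minimal⇒cover {r} A (satA@(0∉A , _) , minimal) 4≤n a a∈A₀ a≢0
  with any? (λ x → ¬? (((A ∖ a) x Bool.≟ true) ⊎-dec (x ∈2? (A ∖ a))))
... | no ¬∃ = ⊥-elim (proj₂ (∖-split A {a} {a}
    (minimal (A ∖ a) (λ x h → proj₁ (∖-split A h)) (avoids , sat) a (∪0-≢0 A a∈A₀ a≢0))) refl)
  where
  avoids : AvoidsZero (A ∖ a)
  avoids h = 0∉A (proj₁ (∖-split A h))
  sat : ∀ x → x ∈ (A ∖ a) ⊎ x ∈2 (A ∖ a)
  sat x = decidable-stable (((A ∖ a) x Bool.≟ true) ⊎-dec (x ∈2? (A ∖ a))) (λ ¬p → ¬∃ (x , ¬p))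
... | yes (x , uncovered) = partner (saturating-basis satA x)
  where
  -- Zero stays covered as b + b for any b in A other than a.
  x≢0 : x ≢ 0v
  x≢0 refl with pick (A ∪0) 4≤n 0v a a
  ... | b , b∈A₀ , b≢0 , b≢a , _ = uncovered (inj₂ (b , b , b∈B , b∈B , sym (⊕-self b)))
    where
    b∈B : b ∈ (A ∖ a)
    b∈B = ∖-join A (∪0-≢0 A b∈A₀ b≢0) b≢a
  uses-a : ∀ z w → z ∈ (A ∪0) → w ∈ (A ∪0) → x ≡ z ⊕ w → z ≡ a ⊎ w ≡ a
  uses-a z w z∈ w∈ eq with z ≟ a | w ≟ a
  ... | yes e | _ = inj₁ e
  ... | no _ | yes e = inj₂ e
  ... | no z≢a | no w≢a with ∪0-split A z∈ | ∪0-split A w∈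
  ...   | inj₁ z∈A | inj₁ w∈A = ⊥-elim (uncovered (inj₂ (z , w , ∖-join A z∈A z≢a , ∖-join A w∈A w≢a , eq)))
  ...   | inj₁ z∈A | inj₂ refl = ⊥-elim (uncovered (inj₁ (subst (_∈ (A ∖ a)) (sym (trans eq (⊕-identityʳ z))) (∖-join A z∈A z≢a))))
  ...   | inj₂ refl | inj₁ w∈A = ⊥-elim (uncovered (inj₁ (subst (_∈ (A ∖ a)) (sym (trans eq (⊕-identityˡ w))) (∖-join A w∈A w≢a))))
  ...   | inj₂ refl | inj₂ refl = ⊥-elim (x≢0 (trans eq (⊕-self 0v)))
  edge : ∀ y → y ∈ (A ∪0) → x ≡ a ⊕ y → ∃[ y ] (y ∈ (A ∪0) × (a ⊕ y) ∈ D (A ∪0))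
  edge y y∈ eq = y , y∈ , ∈D-intro (A ∪0) a∈A₀ y∈
    (λ { refl → x≢0 (trans eq (⊕-self a)) }) unique
    where
    unique : ∀ z w → z ∈ (A ∪0) → w ∈ (A ∪0) → z ⊕ w ≡ a ⊕ y → z ≡ a ⊎ z ≡ y
    unique z w z∈ w∈ e with uses-a z w z∈ w∈ (trans eq (sym e))
    ... | inj₁ z≡a = inj₁ z≡a
    ... | inj₂ refl = inj₂ (trans (sym ([x⊕y]⊕y≡x z a)) (trans (cong (_⊕ a) e) ([x⊕y]⊕x≡y a y)))
  partner : ∃[ p ] ∃[ q ] (p ∈ (A ∪0) × q ∈ (A ∪0) × x ≡ p ⊕ q) → ∃[ y ] (y ∈ (A ∪0) × (a ⊕ y) ∈ D (A ∪0))
  partner (p , q , p∈ , q∈ , eq) with uses-a p q p∈ q∈ eq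
  ... | inj₁ refl = edge q q∈ eq
  ... | inj₂ refl = edge p p∈ (trans eq (⊕-comm p a))

-- The two implications

IsTranslate : ∀ {r} → Subset₂ r → Subset₂ r → V r → Set
IsTranslate A S s = ∀ x → x ∈ A ⇔ (x ≢ 0v × (∃[ y ] ((y ∈ S ⊎ y ≡ 0v) × x ≡ s ⊕ y)))

forward : ∀ {r} (A : Subset₂ r) → AvoidsZero A → 2 ^ r + 10 ≤ 3 * ∑ (λ x → ι ((A ∪0) x)) →
  MinimalSaturating A → ∃[ S ] ∃[ s ] (MaximalSumFree S × (s ∈ S ⊎ s ≡ 0v) × IsTranslate A S s)
forward {r} A 0∉A big minA@(satA , _) = build star
  where
  4≤n : 4 ≤ ∑ (λ x → ι ((A ∪0) x))
  4≤n = big⇒4≤n (2 ^ r) _ big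
  0∈A₀ : 0v ∈ (A ∪0)
  0∈A₀ = ∪0-join A (inj₂ refl)
  open Star (A ∪0) big 0∈A₀ (minimal⇒cover A minA 4≤n)
  open Large (A ∪0) big using (edge-unique)
  build : ∃ IsCentre → ∃[ S ] ∃[ s ] (MaximalSumFree S × (s ∈ S ⊎ s ≡ 0v) × IsTranslate A S s)
  build (c , c∈ , joined) = S , c , (sum-free , maximal) , c∈S₀ , λ x → mk⇔ (to x) (from x)
    where
    S : Subset₂ r
    -- Translation by the centre c moves it to 0, and the other vertices become S.
    S = (λ y → (A ∪0) (c ⊕ y)) ∖ 0v
    S-split : ∀ {y} → y ∈ S → (c ⊕ y) ∈ (A ∪0) × y ≢ 0v
    S-split = ∖-split (λ y → (A ∪0) (c ⊕ y))
    S-join : ∀ {y} → (c ⊕ y) ∈ (A ∪0) → y ≢ 0v → y ∈ S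
    S-join = ∖-join (λ y → (A ∪0) (c ⊕ y))
    c⊕-≡c : ∀ {y} → c ⊕ y ≡ c → y ≡ 0v
    c⊕-≡c {y} e = trans (sym (x⊕[x⊕y]≡y c y)) (trans (cong (c ⊕_) e) (⊕-self c))
    -- A relation x = u + v in S would give c + (c + x), the sum along an edge at the centre, the
    -- second representation (c + u) + (c + v).
    sum-free : SumFree S
    sum-free x x∈S (u , v , u∈S , v∈S , eq) with S-split x∈S | S-split u∈S | S-split v∈S
    ... | cx∈ , x≢0 | cu∈ , u≢0 | cv∈ , v≢0
      with edge-unique c∈ cx∈ (joined (c ⊕ x) cx∈ (λ e → x≢0 (c⊕-≡c e))) cu∈ cv∈
        (trans (⊕-solve (c ∷ u ∷ v ∷ []) ((#0 :⊕ #1) :⊕ #0 :⊕ #2) (#0 :⊕ #0 :⊕ #1 :⊕ #2) refl)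
          (cong (λ t → c ⊕ (c ⊕ t)) (sym eq)))
    ...   | inj₁ e = u≢0 (c⊕-≡c e)
    ...   | inj₂ e = v≢0 (begin
      v                  ≡⟨ sym (x⊕[x⊕y]≡y u v) ⟩
      u ⊕ (u ⊕ v)        ≡⟨ cong (u ⊕_) (sym eq) ⟩
      u ⊕ x              ≡⟨ ⊕-solve (c ∷ u ∷ x ∷ []) (#1 :⊕ #2) ((#0 :⊕ #1) :⊕ #0 :⊕ #2) refl ⟩
      (c ⊕ u) ⊕ (c ⊕ x)  ≡⟨ cong (_⊕ (c ⊕ x)) e ⟩
      (c ⊕ x) ⊕ (c ⊕ x)  ≡⟨ ⊕-self (c ⊕ x) ⟩
      0v                 ∎)
      where open ≡-Reasoning
    -- Write t = p + q in A ∪ {0}. If neither p nor q is c, then c + p and c + q lie in S and sum to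
    -- t, so T is not sum-free. Otherwise t is c plus an element of A ∪ {0}.
    maximal : ∀ T → S ⊆ T → SumFree T → T ⊆ S
    maximal T S⊆T sfT t t∈T with saturating-basis satA t
    ... | p , q , p∈ , q∈ , eq with c ⊕ p ≟ 0v | c ⊕ q ≟ 0v
    ...   | no u≢0 | no v≢0 = ⊥-elim (sfT t t∈T (c ⊕ p , c ⊕ q , S⊆T _ (lift p∈ u≢0) , S⊆T _ (lift q∈ v≢0) ,
      trans eq (⊕-solve (c ∷ p ∷ q ∷ []) (#1 :⊕ #2) ((#0 :⊕ #1) :⊕ #0 :⊕ #2) refl)))
      where
      lift : ∀ {p} → p ∈ (A ∪0) → c ⊕ p ≢ 0v → (c ⊕ p) ∈ S
      lift {p} p∈ = S-join (subst (_∈ (A ∪0)) (sym (x⊕[x⊕y]≡y c p)) p∈)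
    ...   | yes e | _ with x⊕y≡0⇒x≡y c p e
    ...     | refl = S-join (subst (_∈ (A ∪0)) (sym (trans (cong (c ⊕_) eq) (x⊕[x⊕y]≡y c q))) q∈) (λ { refl → SumFree⇒0∉ sfT t∈T })
    maximal T S⊆T sfT t t∈T | p , q , p∈ , q∈ , eq | no _ | yes e with x⊕y≡0⇒x≡y c q e
    ...     | refl = S-join (subst (_∈ (A ∪0)) (sym (trans (cong (c ⊕_) (trans eq (⊕-comm p c))) (x⊕[x⊕y]≡y c p))) p∈)
      (λ { refl → SumFree⇒0∉ sfT t∈T })
    classify : ∀ {y} → (c ⊕ y) ∈ (A ∪0) → Dec (y ≡ 0v) → y ∈ S ⊎ y ≡ 0v
    classify _ (yes e) = inj₂ e
    classify h (no y≢0) = inj₁ (S-join h y≢0)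
    c∈S₀ : c ∈ S ⊎ c ≡ 0v
    c∈S₀ = classify (subst (_∈ (A ∪0)) (sym (⊕-self c)) 0∈A₀) (c ≟ 0v)
    to : ∀ x → x ∈ A → x ≢ 0v × (∃[ y ] ((y ∈ S ⊎ y ≡ 0v) × x ≡ c ⊕ y))
    to x x∈A = (λ { refl → 0∉A x∈A }) , c ⊕ x ,
      classify (subst (_∈ (A ∪0)) (sym (x⊕[x⊕y]≡y c x)) (∪0-join A (inj₁ x∈A))) (c ⊕ x ≟ 0v) ,
      sym (x⊕[x⊕y]≡y c x)
    from : ∀ x → x ≢ 0v × (∃[ y ] ((y ∈ S ⊎ y ≡ 0v) × x ≡ c ⊕ y)) → x ∈ A
    from x (x≢0 , y , inj₁ y∈S , refl) = ∪0-≢0 A (proj₁ (S-split y∈S)) x≢0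
    from x (x≢0 , y , inj₂ refl , refl) = ∪0-≢0 A (subst (_∈ (A ∪0)) (sym (⊕-identityʳ c)) c∈) x≢0

-- If z ≠ 0 is not in 2S, then S ∪ {z} is sum-free: any relation involving z would put z into 2S or
-- 0 into S, or give z = 0. By maximality z is in S.
maximal⇒basis : ∀ {r} {S : Subset₂ r} → MaximalSumFree S →
  ∀ z → ∃[ u ] ∃[ v ] ((u ∈ S ⊎ u ≡ 0v) × (v ∈ S ⊎ v ≡ 0v) × z ≡ u ⊕ v)
maximal⇒basis {r} {S} (sf , maximal) z with z ≟ 0v | z ∈2? S
... | yes refl | _ = 0v , 0v , inj₂ refl , inj₂ refl , sym (⊕-self 0v)
... | no _ | yes (u , v , u∈S , v∈S , eq) = u , v , inj₁ u∈S , inj₁ v∈S , eq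
... | no z≢0 | no z∉2S = z , 0v , inj₁ (maximal S⁺ S⊆S⁺ sum-free z z∈S⁺) , inj₂ refl , sym (⊕-identityʳ z)
  where
  S⁺ : Subset₂ r
  S⁺ x = S x ∨ does (x ≟ z)
  S⊆S⁺ : S ⊆ S⁺
  S⊆S⁺ x = ∨-introˡ
  z∈S⁺ : z ∈ S⁺
  z∈S⁺ = ∨-introʳ {S z} (dec-true (z ≟ z) refl)
  split : ∀ {x} → x ∈ S⁺ → x ∈ S ⊎ x ≡ z
  split {x} h with S x | x ≟ z
  ... | true | _ = inj₁ refl
  ... | false | yes e = inj₂ e
  sum-free : SumFree S⁺
  sum-free x x∈S⁺ (u , v , u∈S⁺ , v∈S⁺ , eq) with split x∈S⁺ | split u∈S⁺ | split v∈S⁺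
  ... | inj₁ x∈S | inj₁ u∈S | inj₁ v∈S = sf x x∈S (u , v , u∈S , v∈S , eq)
  ... | inj₁ x∈S | inj₁ u∈S | inj₂ refl = z∉2S (u , x , u∈S , x∈S , sym (trans (cong (u ⊕_) eq) (x⊕[x⊕y]≡y u v)))
  ... | inj₁ x∈S | inj₂ refl | inj₁ v∈S = z∉2S (x , v , x∈S , v∈S , sym (trans (cong (_⊕ v) eq) ([x⊕y]⊕y≡x u v)))
  ... | inj₁ x∈S | inj₂ refl | inj₂ refl = SumFree⇒0∉ sf (subst (_∈ S) (trans eq (⊕-self z)) x∈S)
  ... | inj₂ refl | inj₁ u∈S | inj₁ v∈S = z∉2S (u , v , u∈S , v∈S , eq)
  ... | inj₂ refl | inj₁ u∈S | inj₂ refl = SumFree⇒0∉ sf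
    (subst (_∈ S) (trans (sym ([x⊕y]⊕y≡x u z)) (trans (cong (_⊕ z) (sym eq)) (⊕-self z))) u∈S)
  ... | inj₂ refl | inj₂ refl | inj₁ v∈S = SumFree⇒0∉ sf
    (subst (_∈ S) (trans (sym (x⊕[x⊕y]≡y z v)) (trans (cong (z ⊕_) (sym eq)) (⊕-self z))) v∈S)
  ... | inj₂ refl | inj₂ refl | inj₂ refl = z≢0 (trans eq (⊕-self z))

-- The shift s cancels in sums of two elements, so S ∪ {0} being a basis makes A ∪ {0} one. For
-- minimality, the elements of S have only one representation each, which forces all of A into B.
backward : ∀ {r} (A : Subset₂ r) → AvoidsZero A → ∃ (_∈ A) →
  ∃[ S ] ∃[ s ] (MaximalSumFree S × (s ∈ S ⊎ s ≡ 0v) × IsTranslate A S s) → MinimalSaturating A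
backward {r} A 0∉A nonempty (S , s , maxS@(sf , _) , s∈S₀ , translate) =
  basis-saturating 0∉A nonempty basis , minimal
  where
  member : ∀ {y} → y ∈ S ⊎ y ≡ 0v → (s ⊕ y) ∈ (A ∪0)
  member {y} y∈ = ∪0-intro A (λ sy≢0 → Equivalence.from (translate (s ⊕ y)) (sy≢0 , y , y∈ , refl))
  basis : ∀ x → ∃[ p ] ∃[ q ] (p ∈ (A ∪0) × q ∈ (A ∪0) × x ≡ p ⊕ q)
  basis x with maximal⇒basis maxS x
  ... | u , v , u∈ , v∈ , eq = s ⊕ u , s ⊕ v , member u∈ , member v∈ ,
    trans eq (⊕-solve (s ∷ u ∷ v ∷ []) (#1 :⊕ #2) ((#0 :⊕ #1) :⊕ #0 :⊕ #2) refl)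
  minimal : ∀ B → B ⊆ A → Saturating B → A ⊆ B
  minimal B B⊆A satB a a∈A = conclude (Equivalence.to (translate a) a∈A)
    where
    -- The adjoined 0 is s + s, which has the required form because s ∈ S ∪ {0}.
    coordinate : ∀ {b} → b ∈ (B ∪0) → ∃[ y ] ((y ∈ S ⊎ y ≡ 0v) × b ≡ s ⊕ y)
    coordinate {b} b∈ with ∪0-split B b∈
    ... | inj₁ b∈B = proj₂ (Equivalence.to (translate b) (B⊆A b b∈B))
    ... | inj₂ refl = s , s∈S₀ , sym (⊕-self s)
    s⊕0 : s ⊕ 0v ≡ s
    s⊕0 = ⊕-identityʳ s
    -- The only representation of u ∈ S as a sum of two elements of s + (S ∪ {0}) is s + (s + u).
    needed : ∀ u → u ∈ S → s ∈ (B ∪0) × (s ⊕ u) ∈ (B ∪0)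
    needed u u∈S with saturating-basis satB u
    ... | b , b′ , b∈ , b′∈ , eq with coordinate b∈ | coordinate b′∈
    ...   | y , y∈ , refl | y′ , y′∈ , refl with y∈ | y′∈
    ...     | inj₁ y∈S | inj₁ y′∈S = ⊥-elim (sf u u∈S (y , y′ , y∈S , y′∈S , trans eq
      (⊕-solve (s ∷ y ∷ y′ ∷ []) ((#0 :⊕ #1) :⊕ #0 :⊕ #2) (#1 :⊕ #2) refl)))
    ...     | inj₂ refl | _ = subst (_∈ (B ∪0)) s⊕0 b∈ , subst (_∈ (B ∪0)) (cong (s ⊕_) (sym (trans eq
      (⊕-solve (s ∷ y′ ∷ []) ((#0 :⊕ :0) :⊕ #0 :⊕ #1) #1 refl)))) b′∈
    ...     | inj₁ _ | inj₂ refl = subst (_∈ (B ∪0)) s⊕0 b′∈ , subst (_∈ (B ∪0)) (cong (s ⊕_) (sym (trans eq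
      (⊕-solve (s ∷ y ∷ []) ((#0 :⊕ #1) :⊕ #0 :⊕ :0) #1 refl)))) b∈
    conclude : a ≢ 0v × (∃[ y ] ((y ∈ S ⊎ y ≡ 0v) × a ≡ s ⊕ y)) → a ∈ B
    conclude (a≢0 , u , inj₁ u∈S , refl) = ∪0-≢0 B (proj₂ (needed u u∈S)) a≢0
    -- Here a = s, and s ≠ 0 puts s into S, so `needed` applies to s itself.
    conclude (a≢0 , u , inj₂ refl , refl) =
      ∪0-≢0 B (subst (_∈ (B ∪0)) (sym s⊕0) (proj₁ (needed s s∈S))) a≢0
      where
      s∈S : s ∈ S
      s∈S = [ (λ h → h) , (λ e → ⊥-elim (a≢0 (trans s⊕0 e))) ]′ s∈S₀

-- The size hypothesis cleared of denominators, carried from c = |A| to |A ∪ {0}| = c + 1.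
size-arith : ∀ N c → N + 6 < 3 * c → N + 10 ≤ 3 * (c + 1)
size-arith N c h = subst₂ _≤_ (e₁ N) (e₂ c) (+-monoˡ-≤ 3 h)
  where
  e₁ : ∀ N → suc (N + 6) + 3 ≡ N + 10
  e₁ = solve-∀
  e₂ : ∀ c → 3 * c + 3 ≡ 3 * (c + 1)
  e₂ = solve-∀

theorem1p1 : (r : ℕ) → 1 ≤ r → (A : Subset₂ r) → AvoidsZero A →
    2 ^ r + 6 < 3 * card A →
    MinimalSaturating A ⇔
    (∃[ S ] ∃[ s ] (MaximalSumFree S × (s ∈ S ⊎ s ≡ 0v) ×
    (∀ x → x ∈ A ⇔ (x ≢ 0v × (∃[ y ] ((y ∈ S ⊎ y ≡ 0v) × x ≡ s ⊕ y))))))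
theorem1p1 r _ A 0∉A large = mk⇔ (forward A 0∉A big) (backward A 0∉A nonempty)
  where
  big : 2 ^ r + 10 ≤ 3 * ∑ (λ x → ι ((A ∪0) x))
  big = subst (λ t → 2 ^ r + 10 ≤ 3 * t) (sym (∑-∪0 A 0∉A)) (size-arith (2 ^ r) (card A) large)
  nonempty : ∃ (_∈ A)
  nonempty with pick (A ∪0) (big⇒4≤n (2 ^ r) _ big) 0v 0v 0v
  ... | a , a∈ , a≢0 , _ = a , ∪0-≢0 A a∈ a≢0
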